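{- There is a deterministic cellular automaton on the line $\mathbb{Z}$, with the standard neighbourhood and with $11$ states, which is strongly universal.
   Context: A deterministic cellular automaton on the line $\mathbb{Z}$ with the standard neighbourhood is given by a finite set $S$ of states and a local rule $f : S^3 \to S$. A configuration is a map $c : \mathbb{Z} \to S$, and the global map $F$ is defined by $F(c)(i) = f(c(i-1), c(i), c(i+1))$, so the neighbourhood of a cell consists of the cell itself, its left-hand neighbour and its right-hand neighbour. The number of states is $|S|$; the quiescent (blank) state is counted among the states. A state $s \in S$ is quiescent if a cell in state $s$ all of whose neighbours are in $s$ remains in $s$ at the next time, i.e. $f(s,s,s) = s$. Fix a quiescent state $q$. A configuration is finite if all cells except finitely many are in state $q$. Halting: the computation $c, F(c), F^2(c), \dots$ halts if and only if two consecutive configurations are identical, i.e. $F^{t+1}(c) = F^t(c)$ for some $t \ge 0$. Strongly universal: the cellular automaton simulates a universal computing device (equivalently, arbitrary Turing machines) under two constraints: the initial configuration is finite, and the cellular automaton halts (in the sense above) exactly when the simulated device halts. Precisely: for every Turing machine $M$ there are a total computable map $\mathrm{enc}$ from inputs of $M$ to finite configurations and a computable map $\mathrm{dec}$ from finite configurations to outputs such that, for every input $x$: (i) if $M$ halts on $x$ with output $y$, then the computation of the cellular automaton started from $\mathrm{enc}(x)$ halts, and the configuration $c$ on which it halts satisfies $\mathrm{dec}(c) = y$; (ii) if $M$ does not halt on $x$, then the computation of the cellular automaton started from $\mathrm{enc}(x)$ does not halt. -}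

module Defs where

open import Data.Nat.Base using (ℕ; zero; suc; _+_; _*_; _<_)
open import Data.Nat.GeneralisedArithmetic using (fold)
open import Data.Integer.Base as ℤ using (ℤ; +_; -[1+_])
open import Data.Integer.Properties using (suc-pred; pred-suc)
open import Data.Fin.Base using (Fin; zero; suc; toℕ)
open import Data.List.Base using (List; []; _∷_; _++_; map)
open import Data.List.Membership.Propositional using (_∈_; _∉_)
open import Data.List.Membership.Propositional.Properties using (∈-map⁺; ∈-++⁺ˡ; ∈-++⁺ʳ)
open import Data.Maybe.Base using (Maybe; just; nothing)
open import Data.Product.Base using (Σ-syntax; ∃-syntax; _×_; _,_; proj₁)
open import Data.Vec.Base as Vec using (Vec; []; _∷_)
open import Data.Vec.Relation.Binary.Pointwise.Inductive using (Pointwise)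
open import Relation.Binary.PropositionalEquality using (_≡_; _≗_; subst)
open import Relation.Nullary using (¬_)

record CellularAutomaton (n : ℕ) : Set where
  field
    rule      : Fin n → Fin n → Fin n → Fin n
    q         : Fin n
    quiescent : rule q q q ≡ q

  Configuration : Set
  Configuration = ℤ → Fin n

  global : Configuration → Configuration
  global c i = rule (c (ℤ.pred i)) (c i) (c (ℤ.suc i))

  Finite : Configuration → Set
  Finite c = Σ[ cells ∈ List ℤ ] (∀ i → i ∉ cells → c i ≡ q)

  FiniteConfiguration : Set
  FiniteConfiguration = Σ[ c ∈ Configuration ] Finite c

  global-finite : ∀ {c} → Finite c → Finite (global c)
  global-finite {c} (cells , outside) = map ℤ.suc cells ++ cells ++ map ℤ.pred cells , blank
    where
    blank : ∀ i → i ∉ map ℤ.suc cells ++ cells ++ map ℤ.pred cells → global c i ≡ q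
    blank i i∉
      rewrite outside (ℤ.pred i)
                (λ p → i∉ (∈-++⁺ˡ (subst (λ j → j ∈ map ℤ.suc cells)
                                     (suc-pred i) (∈-map⁺ ℤ.suc p))))
            | outside i (λ p → i∉ (∈-++⁺ʳ (map ℤ.suc cells) (∈-++⁺ˡ p)))
            | outside (ℤ.suc i)
                (λ p → i∉ (∈-++⁺ʳ (map ℤ.suc cells) (∈-++⁺ʳ cells
                         (subst (λ j → j ∈ map ℤ.pred cells)
                            (pred-suc i) (∈-map⁺ ℤ.pred p)))))
      = quiescent

  step : FiniteConfiguration → FiniteConfiguration
  step (c , fin) = global c , global-finite fin

  after : ℕ → FiniteConfiguration → FiniteConfiguration
  after t c = fold c step t

  HaltsAt : FiniteConfiguration → ℕ → Set
  HaltsAt c t = proj₁ (after (suc t) c) ≗ proj₁ (after t c)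

  Halts : FiniteConfiguration → Set
  Halts c = ∃[ t ] HaltsAt c t

  -- The entries of a half-line, blank beyond the end of the list.
  entry : List (Fin n) → ℕ → Fin n
  entry []      _       = q
  entry (s ∷ _) zero    = s
  entry (_ ∷ w) (suc i) = entry w i

  -- u lists the cells -1, -2, …, and v lists the cells 0, 1, ….
  ⟨_∣_⟩ : List (Fin n) → List (Fin n) → Configuration
  ⟨ u ∣ v ⟩ (+ i)    = entry v i
  ⟨ u ∣ v ⟩ -[1+ i ] = entry u i

data Direction : Set where
  left right : Direction

-- Both lists are read outwards from the head, and all further cells are blank.
record Tape (Symbol : Set) : Set where
  constructor tape
  field
    leftward  : List Symbol
    scanned   : Symbol
    rightward : List Symbol

-- One two-way infinite tape; the blank is the symbol zero, and the letters of
-- the input and output words are the k other symbols.  The machine halts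
-- where δ is undefined.
record TuringMachine : Set where
  field
    states : ℕ
    k      : ℕ
    start  : Fin states
    δ      : Fin states → Fin (suc k) → Maybe (Fin states × Fin (suc k) × Direction)

  Symbol : Set
  Symbol = Fin (suc k)

  Word : Set
  Word = List (Fin k)

  move : Direction → Tape Symbol → Tape Symbol
  move left  (tape []      a r)       = tape [] zero (a ∷ r)
  move left  (tape (b ∷ l) a r)       = tape l b (a ∷ r)
  move right (tape l       a [])      = tape (a ∷ l) zero []
  move right (tape l       a (b ∷ r)) = tape (a ∷ l) b r

  ID : Set
  ID = Fin states × Tape Symbol

  step : ID → Maybe ID
  step (p , tape l a r) with δ p a
  ... | nothing            = nothing
  ... | just (p′ , a′ , d) = just (p′ , move d (tape l a′ r))

  initial : Word → ID
  initial []      = start , tape [] zero []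
  initial (x ∷ w) = start , tape [] (suc x) (map suc w)

  untilBlank : List Symbol → Word
  untilBlank []          = []
  untilBlank (zero  ∷ _) = []
  untilBlank (suc x ∷ w) = x ∷ untilBlank w

  -- The output is the blank-free word that begins at the head.
  output : ID → Word
  output (_ , tape _ a r) = untilBlank (a ∷ r)

  data _⇓_ : ID → Word → Set where
    stop : ∀ {c}      → step c ≡ nothing          → c ⇓ output c
    next : ∀ {c c′ y} → step c ≡ just c′ → c′ ⇓ y → c ⇓ y

  HaltsOn_WithOutput_ : Word → Word → Set
  HaltsOn x WithOutput y = initial x ⇓ y

  HaltsOn : Word → Set
  HaltsOn x = ∃[ y ] HaltsOn x WithOutput y

-- Kleene's partial recursive functions; _[_]↦_ is their evaluation relation.
data Recursive : ℕ → Set where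
  zero : Recursive 0
  succ : Recursive 1
  proj : ∀ {n} → Fin n → Recursive n
  comp : ∀ {m n} → Recursive m → Vec (Recursive n) m → Recursive n
  prec : ∀ {n} → Recursive n → Recursive (2 + n) → Recursive (suc n)
  min  : ∀ {n} → Recursive (suc n) → Recursive n

data _[_]↦_ : ∀ {n} → Recursive n → Vec ℕ n → ℕ → Set where
  zero   : zero [ [] ]↦ 0
  succ   : ∀ {x} → succ [ x ∷ [] ]↦ suc x
  proj   : ∀ {n} {i : Fin n} {xs} → proj i [ xs ]↦ Vec.lookup xs i
  comp   : ∀ {m n} {f : Recursive m} {gs : Vec (Recursive n) m} {xs ys z} →
           Pointwise (λ g y → g [ xs ]↦ y) gs ys → f [ ys ]↦ z →
           comp f gs [ xs ]↦ z
  prec-0 : ∀ {n} {f : Recursive n} {g xs z} →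
           f [ xs ]↦ z → prec f g [ 0 ∷ xs ]↦ z
  prec-s : ∀ {n} {f : Recursive n} {g xs i y z} →
           prec f g [ i ∷ xs ]↦ y → g [ i ∷ y ∷ xs ]↦ z →
           prec f g [ suc i ∷ xs ]↦ z
  min    : ∀ {n} {f : Recursive (suc n)} {xs y} →
           f [ y ∷ xs ]↦ 0 → (∀ z → z < y → ∃[ r ] f [ z ∷ xs ]↦ suc r) →
           min f [ xs ]↦ y

-- An element may have several codes (for instance, a finite configuration can
-- be written down with any number of blanks at its ends).
record Coding (A : Set) : Set₁ where
  field
    arity   : ℕ
    _codes_ : Vec ℕ arity → A → Set

-- The programs must send every code of a to a code of f a.  In particular a
-- computable map on finite configurations respects pointwise equality.
Computable : ∀ {A B} → Coding A → Coding B → (A → B) → Set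
Computable 𝒜 ℬ f =
  Σ[ es ∈ Vec (Recursive 𝒜.arity) ℬ.arity ]
    (∀ a xs → xs 𝒜.codes a →
      ∃[ ys ] Pointwise (λ e y → e [ xs ]↦ y) es ys × ys ℬ.codes f a)
  where
  module 𝒜 = Coding 𝒜
  module ℬ = Coding ℬ

-- Bijective base-k numeration, with least significant letter first.
code : ∀ {k} → List (Fin k) → ℕ
code     []      = 0
code {k} (x ∷ w) = suc (toℕ x) + k * code w

wordCoding : ∀ k → Coding (List (Fin k))
wordCoding k = record { arity = 1 ; _codes_ = λ xs w → xs ≡ code w ∷ [] }

configurationCoding : ∀ {n} (A : CellularAutomaton n) →
                      Coding (CellularAutomaton.FiniteConfiguration A)
configurationCoding A = record
  { arity   = 2
  ; _codes_ = λ xs c → ∃[ u ] ∃[ v ] xs ≡ code u ∷ code v ∷ [] × ⟨ u ∣ v ⟩ ≗ proj₁ c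
  }
  where open CellularAutomaton A

record Simulates {n} (A : CellularAutomaton n) (M : TuringMachine) : Set where
  open CellularAutomaton A using (FiniteConfiguration; HaltsAt; Halts; after)
  open TuringMachine M using (k; Word; HaltsOn_WithOutput_; HaltsOn)
  field
    enc            : Word → FiniteConfiguration
    dec            : FiniteConfiguration → Word
    enc-computable : Computable (wordCoding k) (configurationCoding A) enc
    dec-computable : Computable (configurationCoding A) (wordCoding k) dec
    halting        : ∀ x y → HaltsOn x WithOutput y →
                     ∃[ t ] HaltsAt (enc x) t × dec (after t (enc x)) ≡ y
    non-halting    : ∀ x → ¬ HaltsOn x → ¬ Halts (enc x)

StronglyUniversal : ∀ {n} → CellularAutomaton n → Set
StronglyUniversal A = ∀ (M : TuringMachine) → Simulates A M

{-# OPTIONS --safe #-}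
module Submission where

-- A Turing machine with k + 1 symbols is simulated by a tag system with deletion
-- number k + 1.  The two halves of the tape are numbers in base k + 1, written in
-- unary as runs of letters: multiplication is done by the productions, and division
-- by the deletion, the remainder being the offset at which the following word is read.
-- Letters are coded in one-hot fashion, so that the tag system becomes a cyclic tag
-- system; each of its lines reads a bit and, if this is 1, appends a word.
--
-- The automaton keeps the cyclic tag system on the line as
--   1 1 | c₁ | c₂ | … | cₙ | | | … | queue
-- with slots |, letters cᵢ (0 and 1 append that bit, blank reads the next bit), and a
-- queue of bits that moves to the right and leaves slots behind.  A single head shuttles
-- between program and queue, a mark in the slot before the letter in execution being the
-- program counter.  A bit 0, when read, becomes a mark in front of the queue, from which
-- the signals that would append bounce back.  Two adjacent bits 1 at the front of
-- the queue absorb the head: this is halting, and it occurs just when the simulated machine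
-- halts.  The output is then recovered from the number of cells in state 1.

open import Defs
open import Data.Bool.Base using (Bool; true; false)
open import Data.Empty using (⊥)
open import Data.Fin.Base using (Fin; zero; suc; toℕ; fromℕ<; opposite; combine; remQuot; splitAt; _↑ˡ_; _↑ʳ_)
open import Data.Fin.Patterns
open import Data.Fin.Properties
  using (opposite-prop; opposite-involutive; splitAt-↑ˡ; splitAt-↑ʳ; remQuot-combine; toℕ<n; toℕ-fromℕ<; fromℕ<-toℕ)
open import Data.Integer.Base as ℤ using (ℤ; -[1+_]; ∣_∣)
open import Data.Integer.Properties using (suc-pred; pred-suc)
open import Data.List.Base as List
  using (List; []; _∷_; _++_; [_]; map; replicate; concat; concatMap; tabulate; length; take; drop; foldr; applyUpTo; upTo)
open import Data.List.Membership.Propositional using (_∈_; _∉_)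
open import Data.List.Membership.Propositional.Properties using (∈-map⁺; ∈-++⁺ˡ; ∈-++⁺ʳ; ∈-upTo⁺)
open import Data.List.Properties
open import Data.List.Relation.Unary.Any using (here; there)
open import Data.Maybe.Base using (Maybe; just; nothing)
open import Data.Nat.Base using (ℕ; zero; suc; pred; _+_; _*_; _∸_; _^_; _⊓_; _⊔_; _≤_; _<_; z≤n; s≤s)
open import Data.Nat.GeneralisedArithmetic using (fold)
open import Data.Nat.Properties hiding (suc-pred)
open import Data.Nat.Solver using (module +-*-Solver)
open import Data.Product.Base using (Σ-syntax; ∃-syntax; _×_; _,_; proj₁; proj₂)
open import Data.Sum.Base using ([_,_]′)
open import Data.Unit.Base using (⊤; tt)
open import Data.Vec.Base using (Vec; []; _∷_; lookup)
open import Data.Vec.Relation.Binary.Pointwise.Inductive using ([]; _∷_)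
open import Function.Base using (_∘_)
open import Relation.Binary.Construct.Closure.ReflexiveTransitive using (Star; ε; _◅_; _◅◅_)
open import Relation.Binary.PropositionalEquality hiding ([_])
open import Relation.Nullary using (¬_; yes; no)
open import Relation.Nullary.Negation using (contradiction)

-- The automaton

data Passive : Set where
  blank slot mark : Passive
  bit             : Bool → Passive

-- next also carries the program counter over an executed letter, and rewind also
-- disposes of the bit that has been read.
data Head : Set where
  read return next rewind : Head
  write                   : Bool → Head

data Cell : Set where
  passive : Passive → Cell
  head    : Head → Cell

fromLeft : Head → Passive → Passive → Cell
fromLeft read      slot       _          = head read
fromLeft read      mark       _          = head read
fromLeft read      (bit _)    slot       = head read
fromLeft read      (bit true) (bit true) = passive (bit true)
fromLeft read      (bit _)    _          = head rewind
fromLeft read      blank      slot       = head read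
fromLeft (write b) slot       _          = head (write b)
fromLeft (write b) (bit _)    _          = head (write b)
fromLeft (write b) blank      slot       = head (write b)
fromLeft (write b) blank      _          = head return
fromLeft next      slot       slot       = head rewind
fromLeft next      slot       blank      = head read
fromLeft next      slot       (bit b)    = head (write b)
fromLeft next      blank      _          = head next
fromLeft next      (bit _)    _          = head next
fromLeft _         c          _          = passive c

-- The second argument is the cell itself, the third its left neighbour.
fromRight : Head → Passive → Passive → Cell
fromRight return mark       _     = passive slot
fromRight return _          _     = head return
fromRight rewind slot       slot  = passive slot
fromRight rewind (bit true) blank = passive (bit true)
fromRight rewind _          _     = head rewind
fromRight _      c          _     = passive c

centre : Head → Passive → Passive → Cell
centre read      _           mark       = passive slot
centre read      _           r          = passive r
centre (write _) _           mark       = head return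
centre (write b) (bit _)     blank      = passive (bit b)
centre (write _) _           r          = passive r
centre return    mark        _          = head next
centre return    l           _          = passive l
centre next      _           slot       = passive mark
centre next      _           r          = passive r
centre rewind    mark        _          = passive slot
-- A rewinding head stands between two 1s only inside `sentinel`, because two adjacent 1s at the
-- front of the queue absorb the reading head earlier.
centre rewind    (bit true)  (bit true) = head next
centre rewind    (bit b)     slot       = passive (bit b)
centre rewind    (bit true)  _          = passive slot
centre rewind    (bit false) _          = passive mark
centre rewind    blank       _          = passive blank
-- Letters separate the slots of the program, so a slot on the left with a slot or mark on the right
-- occurs only just after a bit has been read. There the head turns into `return`.
centre rewind    slot        slot       = head return
centre rewind    slot        mark       = head return
centre rewind    slot        _          = passive slot

-- A moving head trades places with the passive cell ahead: `fromLeft` or `fromRight` puts the head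
-- into that cell, and `centre` puts the old content where the head was. So no head state has to
-- remember what lies under it.
local : Cell → Cell → Cell → Cell
local (passive l) (passive c) (passive r) = passive c
local (head h)    (passive c) (passive r) = fromLeft h c r
local (passive l) (head h)    (passive r) = centre h l r
local (passive l) (passive c) (head h)    = fromRight h c l
local _           c           _           = c

⌊_⌋ : Cell → Fin 11
⌊ passive blank       ⌋ = 0F
⌊ passive (bit true)  ⌋ = 1F
⌊ passive (bit false) ⌋ = 2F
⌊ passive slot        ⌋ = 3F
⌊ passive mark        ⌋ = 4F
⌊ head read           ⌋ = 5F
⌊ head (write true)   ⌋ = 6F
⌊ head (write false)  ⌋ = 7F
⌊ head return         ⌋ = 8F
⌊ head next           ⌋ = 9F
⌊ head rewind         ⌋ = suc 9F

⌈_⌉ : Fin 11 → Cell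
⌈ 0F ⌉ = passive blank
⌈ 1F ⌉ = passive (bit true)
⌈ 2F ⌉ = passive (bit false)
⌈ 3F ⌉ = passive slot
⌈ 4F ⌉ = passive mark
⌈ 5F ⌉ = head read
⌈ 6F ⌉ = head (write true)
⌈ 7F ⌉ = head (write false)
⌈ 8F ⌉ = head return
⌈ 9F ⌉ = head next
⌈ suc 9F ⌉ = head rewind

⌈⌊⌋⌉ : ∀ c → ⌈ ⌊ c ⌋ ⌉ ≡ c
⌈⌊⌋⌉ (passive blank)       = refl
⌈⌊⌋⌉ (passive slot)        = refl
⌈⌊⌋⌉ (passive mark)        = refl
⌈⌊⌋⌉ (passive (bit true))  = refl
⌈⌊⌋⌉ (passive (bit false)) = refl
⌈⌊⌋⌉ (head read)           = refl
⌈⌊⌋⌉ (head return)         = refl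
⌈⌊⌋⌉ (head next)           = refl
⌈⌊⌋⌉ (head rewind)         = refl
⌈⌊⌋⌉ (head (write true))   = refl
⌈⌊⌋⌉ (head (write false))  = refl

automaton : CellularAutomaton 11
automaton = record
  { rule      = λ l c r → ⌊ local ⌈ l ⌉ ⌈ c ⌉ ⌈ r ⌉ ⌋
  ; q         = 0F
  ; quiescent = refl
  }

open CellularAutomaton automaton
  using (Configuration; FiniteConfiguration; Finite; global; after; HaltsAt; Halts; entry; ⟨_∣_⟩)

-- Snapshots of configurations and their evolution

first : List Passive → Passive
first []      = blank
first (c ∷ _) = c

rest : List Passive → List Passive
rest []      = []
rest (_ ∷ w) = w

-- The cells p, p + 1, … and p, p - 1, … respectively; blank beyond the list.
Rightward Leftward : Configuration → ℤ → List Passive → Set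
Rightward c p []      = ∀ i → c (fold p ℤ.suc i) ≡ ⌊ passive blank ⌋
Rightward c p (a ∷ w) = c p ≡ ⌊ passive a ⌋ × Rightward c (ℤ.suc p) w
Leftward c p []      = ∀ i → c (fold p ℤ.pred i) ≡ ⌊ passive blank ⌋
Leftward c p (a ∷ w) = c p ≡ ⌊ passive a ⌋ × Leftward c (ℤ.pred p) w

fold-shift : ∀ {A : Set} (f : A → A) p i → fold (f p) f i ≡ f (fold p f i)
fold-shift f p zero    = refl
fold-shift f p (suc i) = cong f (fold-shift f p i)

rightward-fst : ∀ {c p} w → Rightward c p w → c p ≡ ⌊ passive (first w) ⌋
rightward-fst []      r       = r 0
rightward-fst (_ ∷ _) (e , _) = e

leftward-fst : ∀ {c p} w → Leftward c p w → c p ≡ ⌊ passive (first w) ⌋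
leftward-fst []      r       = r 0
leftward-fst (_ ∷ _) (e , _) = e

rightward-rest : ∀ {c p} w → Rightward c p w → Rightward c (ℤ.suc p) (rest w)
rightward-rest {c} {p} [] r i = trans (cong c (fold-shift ℤ.suc p i)) (r (suc i))
rightward-rest (_ ∷ _) (_ , r) = r

leftward-rest : ∀ {c p} w → Leftward c p w → Leftward c (ℤ.pred p) (rest w)
leftward-rest {c} {p} [] r i = trans (cong c (fold-shift ℤ.pred p i)) (r (suc i))
leftward-rest (_ ∷ _) (_ , r) = r

global-at : ∀ c i l m r → c (ℤ.pred i) ≡ ⌊ l ⌋ → c i ≡ ⌊ m ⌋ → c (ℤ.suc i) ≡ ⌊ r ⌋ →
            global c i ≡ ⌊ local l m r ⌋
global-at c i l m r e₁ e₂ e₃ rewrite e₁ | e₂ | e₃ | ⌈⌊⌋⌉ l | ⌈⌊⌋⌉ m | ⌈⌊⌋⌉ r = refl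

global-rightward : ∀ {c p} a w → c (ℤ.pred p) ≡ ⌊ passive a ⌋ → Rightward c p w → Rightward (global c) p w
global-rightward {c} {p} a [] e r zero = global-at c p (passive a) (passive blank) (passive blank) e (r 0) (r 1)
global-rightward {c} {p} a [] e r (suc i) = global-at c (fold p ℤ.suc (suc i)) (passive blank) (passive blank) (passive blank)
  (trans (cong c (pred-suc (fold p ℤ.suc i))) (r i)) (r (suc i)) (r (suc (suc i)))
global-rightward {c} {p} a (b ∷ w) e (e′ , r) =
  global-at c p (passive a) (passive b) (passive (first w)) e e′ (rightward-fst w r) ,
  global-rightward b w (trans (cong c (pred-suc p)) e′) r

global-leftward : ∀ {c p} a w → c (ℤ.suc p) ≡ ⌊ passive a ⌋ → Leftward c p w → Leftward (global c) p w
global-leftward {c} {p} a [] e r zero = global-at c p (passive blank) (passive blank) (passive a) (r 1) (r 0) e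
global-leftward {c} {p} a [] e r (suc i) = global-at c (fold p ℤ.pred (suc i)) (passive blank) (passive blank) (passive blank)
  (r (suc (suc i))) (r (suc i)) (trans (cong c (suc-pred (fold p ℤ.pred i))) (r i))
global-leftward {c} {p} a (b ∷ w) e (e′ , r) =
  global-at c p (passive (first w)) (passive b) (passive a) (leftward-fst w r) e′ e ,
  global-leftward b w (trans (cong c (suc-pred p)) e′) r

-- The half-lines are read outwards; invalid stands for more than one head.
data Snapshot : Set where
  dead : List Passive → List Passive → Snapshot
  live : List Passive → Head → List Passive → Snapshot
  invalid : Snapshot

Shows : Configuration → Snapshot → Set
Shows c (dead l r)   = ∃[ p ] Leftward c (ℤ.pred p) l × Rightward c p r
Shows c (live l h r) = ∃[ p ] Leftward c (ℤ.pred p) l × c p ≡ ⌊ head h ⌋ × Rightward c (ℤ.suc p) r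
Shows c invalid         = ⊥

assemble : List Passive → Cell → Cell → Cell → List Passive → Snapshot
assemble l (passive a) (passive b) (passive c) r = dead (a ∷ l) (b ∷ c ∷ r)
assemble l (head h)    (passive b) (passive c) r = live l h (b ∷ c ∷ r)
assemble l (passive a) (head h)    (passive c) r = live (a ∷ l) h (c ∷ r)
assemble l (passive a) (passive b) (head h)    r = live (b ∷ a ∷ l) h r
assemble l _           _           _           r = invalid

advance : Snapshot → Snapshot
advance (live l h r) = assemble (rest l)
  (fromRight h (first l) (first (rest l))) (centre h (first l) (first r)) (fromLeft h (first r) (first (rest r)))
  (rest r)
advance z = z

Proper : Snapshot → Set
Proper invalid = ⊥
Proper _    = ⊤

assemble-shows : ∀ {c p} l r x₁ x₂ x₃ → Proper (assemble l x₁ x₂ x₃ r) →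
  Leftward c (ℤ.pred (ℤ.pred p)) l → c (ℤ.pred p) ≡ ⌊ x₁ ⌋ → c p ≡ ⌊ x₂ ⌋ → c (ℤ.suc p) ≡ ⌊ x₃ ⌋ →
  Rightward c (ℤ.suc (ℤ.suc p)) r → Shows c (assemble l x₁ x₂ x₃ r)
assemble-shows {c} {p} l r (passive a) (passive b) (passive d) _ L e₁ e₂ e₃ R = p , (e₁ , L) , (e₂ , e₃ , R)
assemble-shows {c} {p} l r (head h) (passive b) (passive d) _ L e₁ e₂ e₃ R =
  ℤ.pred p , L , e₁ , subst (λ i → Rightward c i (b ∷ d ∷ r)) (sym (suc-pred p)) (e₂ , e₃ , R)
assemble-shows {c} {p} l r (passive a) (head h) (passive d) _ L e₁ e₂ e₃ R = p , (e₁ , L) , e₂ , (e₃ , R)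
assemble-shows {c} {p} l r (passive a) (passive b) (head h) _ L e₁ e₂ e₃ R =
  ℤ.suc p , subst (λ i → Leftward c i (b ∷ a ∷ l)) (sym (pred-suc p)) (e₂ , e₁ , L) , e₃ , R

infix 4 _↦_ _↦*_

-- The position of the head is existential in `Shows`, so runs compose without keeping track of
-- coordinates.
record _↦_ (z z′ : Snapshot) : Set where
  constructor sound
  field shows : ∀ {c} → Shows c z → Shows (global c) z′
open _↦_

_↦*_ : Snapshot → Snapshot → Set
_↦*_ = Star _↦_

infix 4 _↦⁺_
infixr 5 _◅◅⁺_

_↦⁺_ : Snapshot → Snapshot → Set
z ↦⁺ z′ = ∃[ y ] z ↦ y × y ↦* z′

_◅◅⁺_ : ∀ {x y z} → x ↦* y → y ↦⁺ z → x ↦⁺ z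
ε        ◅◅⁺ run            = run
(s ◅ ss) ◅◅⁺ (y , s′ , run) = _ , s , ss ◅◅ s′ ◅ run

-- Only the head and its two neighbours can change; all other neighbourhoods are passive. On
-- concrete snapshots the premise computes to the unit type, so a single transition is proved by
-- `tick tt`.
tick : ∀ {l h r} → Proper (advance (live l h r)) → live l h r ↦ advance (live l h r)
shows (tick {l} {h} {r} ok) {c} (p , L , e , R) = assemble-shows {p = p} (rest l) (rest r) _ _ _ ok
  (global-leftward (first l) (rest l) (trans (cong c (suc-pred (ℤ.pred p))) (leftward-fst l L)) (leftward-rest l L))
  (global-at c (ℤ.pred p) (passive (first (rest l))) (passive (first l)) (head h)
    (leftward-fst (rest l) (leftward-rest l L)) (leftward-fst l L) (trans (cong c (suc-pred p)) e))
  (global-at c p (passive (first l)) (head h) (passive (first r)) (leftward-fst l L) e (rightward-fst r R))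
  (global-at c (ℤ.suc p) (head h) (passive (first r)) (passive (first (rest r)))
    (trans (cong c (pred-suc p)) e) (rightward-fst r R) (rightward-fst (rest r) (rightward-rest r R)))
  (global-rightward (first r) (rest r) (trans (cong c (pred-suc (ℤ.suc p))) (rightward-fst r R)) (rightward-rest r R))

rightward-trim : ∀ {c p} w → Rightward c p (first w ∷ rest w) → Rightward c p w
rightward-trim (_ ∷ _) r = r
rightward-trim [] (e , r) zero    = e
rightward-trim {c} {p} [] (e , r) (suc i) = trans (cong c (sym (fold-shift ℤ.suc p i))) (r i)

shows-trim : ∀ {c l h a} w → Shows c (live l h (a ∷ first w ∷ rest w)) → Shows c (live l h (a ∷ w))
shows-trim w (p , L , e , e′ , R) = p , L , e , e′ , rightward-trim w R

-- `advance` rebuilds the right half-line from `first` and `rest`, which makes an explicit blank out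
-- of an empty list. Both lists show the same cells.
trimmed : ∀ {z l h a} w → z ↦ live l h (a ∷ first w ∷ rest w) → z ↦ live l h (a ∷ w)
shows (trimmed {z} {l} {h} {a} w st) {c} sh = shows-trim {global c} {l} {h} {a} w (shows st sh)

shows-run : ∀ {c z z′} → z ↦* z′ → Shows c z → ∃[ t ] Shows (fold c global t) z′
shows-run ε sh = 0 , sh
shows-run {c} (st ◅ run) sh with shows-run run (shows st sh)
... | t , sh′ = suc t , subst (λ d → Shows d _) (fold-shift global c t) sh′

-- Cyclic tag systems on the line

Letter : Set
Letter = Maybe Bool

cell : Letter → Passive
cell nothing  = blank
cell (just b) = bit b

emit : Letter → Head
emit nothing  = read
emit (just b) = write b

-- Each letter stands between slots. The two adjacent slots at the end tell `next` that the program
-- is over, and tell `rewind` that it is in front of the queue.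
prog body : List Letter → List Passive → List Passive
prog cs t = slot ∷ body cs t
body []       t = slot ∷ t
body (c ∷ cs) t = cell c ∷ prog cs t

return-over : ∀ {a l r} → fromRight return a (first l) ≡ head return → centre return a (first r) ≡ passive a →
              live (a ∷ l) return r ↦ live l return (a ∷ r)
return-over {a} {l} {r} e₁ e₂ = trimmed r (subst (live (a ∷ l) return r ↦_) eq (tick (subst Proper (sym eq) tt)))
  where
  eq : advance (live (a ∷ l) return r) ≡ live l return (a ∷ first r ∷ rest r)
  eq rewrite e₁ | e₂ = refl

return-slot : ∀ {l r} → live (slot ∷ l) return r ↦ live l return (slot ∷ r)
return-slot {l} {r} = return-over {slot} {l} {r} refl refl

return-bit : ∀ {b l r} → live (bit b ∷ l) return r ↦ live l return (bit b ∷ r)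
return-bit {b} {l} {r} = return-over {bit b} {l} {r} refl refl

return-cell : ∀ c {l r} → live (cell c ∷ l) return r ↦ live l return (cell c ∷ r)
return-cell nothing  {l} {r} = return-over {blank} {l} {r} refl refl
return-cell (just b) {l} {r} = return-bit {b} {l} {r}

emit-slot : ∀ c {a l r} → live (a ∷ l) (emit c) (slot ∷ r) ↦ live (slot ∷ a ∷ l) (emit c) r
emit-slot nothing  = tick tt
emit-slot (just b) = tick tt

-- The two slots on the left, which close the program or remain from consumed bits, are what turns
-- the head round after it has read a bit.
Op : Letter → List Passive → List Passive → Set
Op c t t′ = ∀ l → live (slot ∷ slot ∷ l) (emit c) t ↦* live (slot ∷ slot ∷ l) return t′

op-slots : ∀ c {t t′} g → Op c t t′ → Op c (replicate g slot ++ t) (replicate g slot ++ t′)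
op-slots c zero    op l = op l
op-slots c (suc g) op l = emit-slot c ◅ op-slots c g op (slot ∷ l) ◅◅ return-slot ◅ ε

-- The last bit read was 0 in the closed case, so that appending is blocked by the mark, and 1 in
-- the opened case. The `g` slots are the room left by consumed bits.
closed opened : ℕ → List Bool → List Passive
closed g w = replicate g slot ++ mark ∷ map bit w
opened g w = replicate g slot ++ map bit w

replicate-shift : ∀ {A : Set} g {a : A} t → replicate g a ++ a ∷ t ≡ replicate (suc g) a ++ t
replicate-shift zero    t = refl
replicate-shift (suc g) t = cong (_ ∷_) (replicate-shift g t)

write-closed : ∀ b g w → Op (just b) (closed g w) (closed g w)
write-closed b g w = op-slots (just b) g (λ l → tick tt ◅ ε)

-- A writing head recognises the end of the queue by a bit on its left and a blank on its right.
-- Hence the bit `c`, without which the end would look like a blank letter of the program.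
write-bits : ∀ b c w l → live (bit c ∷ l) (write b) (map bit w) ↦* live (bit c ∷ l) return (map bit (w ++ b ∷ []))
write-bits b c []      l = tick tt ◅ return-bit ◅ ε
write-bits b c (d ∷ w) l = tick tt ◅ write-bits b d w (bit c ∷ l) ◅◅ return-bit ◅ ε

write-opened : ∀ b g c w → Op (just b) (opened g (c ∷ w)) (opened g (c ∷ w ++ b ∷ []))
write-opened b g c w = op-slots (just b) g (λ l → tick tt ◅ write-bits b c w _ ◅◅ return-bit ◅ ε)

read-false : ∀ w → Op nothing (map bit (false ∷ w)) (closed 0 w)
read-false []      l = tick tt ◅ tick tt ◅ trimmed [] (tick tt) ◅ ε
read-false (b ∷ w) l = tick tt ◅ tick tt ◅ tick tt ◅ ε

-- The 0 behind the 1 is essential: another 1 there would absorb the head.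
read-true : ∀ w → Op nothing (map bit (true ∷ false ∷ w)) (opened 1 (false ∷ w))
read-true w l = tick tt ◅ tick tt ◅ tick tt ◅ ε

-- On its way to the first bit the reading head turns the mark of the preceding 0 into one more
-- slot.
read-closed : ∀ g {w t} → Op nothing (map bit w) t →
              Op nothing (closed g w) (replicate (suc g) slot ++ t)
read-closed g {w} {t} op = subst (Op nothing (closed g w)) (replicate-shift g t) (op-slots nothing g unblock)
  where
  unblock : Op nothing (mark ∷ map bit w) (slot ∷ t)
  unblock l = tick tt ◅ op (slot ∷ l) ◅◅ return-slot ◅ ε

read-closed-false : ∀ g w → Op nothing (closed g (false ∷ w)) (closed (suc g) w)
read-closed-false g w = read-closed g {false ∷ w} (read-false w)

read-closed-true : ∀ g w → Op nothing (closed g (true ∷ false ∷ w)) (opened (2 + g) (false ∷ w))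
read-closed-true g w = subst (Op nothing (closed g (true ∷ false ∷ w)))
  (replicate-shift (suc g) (map bit (false ∷ w))) (read-closed g {true ∷ false ∷ w} (read-true w))

read-opened-false : ∀ g w → Op nothing (opened g (false ∷ w)) (closed g w)
read-opened-false g w = op-slots nothing g (read-false w)

-- A writing head with a bit on its left would deposit its own bit at a blank letter; so letters are
-- entered from a slot or from the program counter.
data Seam : Passive → Set where
  slot : Seam slot
  mark : Seam mark

emit-cell : ∀ c d {a l r} → Seam a →
            live (a ∷ l) (emit c) (cell d ∷ slot ∷ r) ↦ live (cell d ∷ a ∷ l) (emit c) (slot ∷ r)
emit-cell nothing  nothing  slot = tick tt
emit-cell nothing  nothing  mark = tick tt
emit-cell nothing  (just _) slot = tick tt
emit-cell nothing  (just _) mark = tick tt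
emit-cell (just _) nothing  slot = tick tt
emit-cell (just _) nothing  mark = tick tt
emit-cell (just _) (just _) slot = tick tt
emit-cell (just _) (just _) mark = tick tt

-- The signal restores the rest of the program on its way out and back, so that only its effect on
-- the queue remains.
through : ∀ c d cs {t t′ a} l → Op c t t′ → Seam a →
          live (a ∷ l) (emit c) (cell d ∷ prog cs t) ↦* live (a ∷ l) return (cell d ∷ prog cs t′)
through c d [] l op sa =
  emit-cell c d sa ◅ emit-slot c ◅ emit-slot c ◅ op _ ◅◅ return-slot ◅ return-slot ◅ return-cell d ◅ ε
through c d (e ∷ cs) l op sa =
  emit-cell c d sa ◅ emit-slot c ◅ through c e cs _ op slot ◅◅ return-slot ◅ return-cell d ◅ ε

next-cell : ∀ c {a l r} → live (a ∷ l) next (cell c ∷ slot ∷ r) ↦ live (cell c ∷ a ∷ l) next (slot ∷ r)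
next-cell nothing  = tick tt
next-cell (just _) = tick tt

emit-next : ∀ c {a l r} → live (a ∷ l) next (slot ∷ cell c ∷ r) ↦ live (mark ∷ a ∷ l) (emit c) (cell c ∷ r)
emit-next nothing  = tick tt
emit-next (just _) = tick tt

resume : ∀ c {a l r} → live (mark ∷ a ∷ l) return (cell c ∷ slot ∷ r) ↦ live (slot ∷ a ∷ l) next (cell c ∷ slot ∷ r)
resume nothing  = tick tt
resume (just _) = tick tt

-- This is the executed part of the program as seen outwards from the head, hence reversed.
onto : List Letter → List Passive → List Passive
onto []       l = l
onto (c ∷ cs) l = onto cs (cell c ∷ slot ∷ l)

data Exec : List Letter → List Passive → List Passive → Set where
  []  : ∀ {t} → Exec [] t t
  _∷_ : ∀ {c cs t t′ t″} → Op c t t′ → Exec cs t′ t″ → Exec (c ∷ cs) t t″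

infixr 5 _++ₑ_
_++ₑ_ : ∀ {cs ds t t′ t″} → Exec cs t t′ → Exec ds t′ t″ → Exec (cs ++ ds) t t″
[]       ++ₑ es = es
(o ∷ os) ++ₑ es = o ∷ (os ++ₑ es)

execute : ∀ {cs t t′} d l → Exec cs t t′ →
          live (cell d ∷ l) next (prog cs t) ↦* live (onto cs (cell d ∷ l)) next (prog [] t′)
execute d l [] = ε
execute {c ∷ cs} d l (op ∷ ops) =
  emit-next c ◅ through c c cs (cell d ∷ l) op mark ◅◅ resume c ◅ next-cell c ◅ execute c (slot ∷ cell d ∷ l) ops

rewind-cell : ∀ c d {l r} →
  live (cell c ∷ slot ∷ cell d ∷ l) rewind (slot ∷ r) ↦* live (cell d ∷ l) rewind (slot ∷ cell c ∷ slot ∷ r)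
rewind-cell nothing      nothing  = tick tt ◅ tick tt ◅ ε
rewind-cell nothing      (just _) = tick tt ◅ tick tt ◅ ε
rewind-cell (just true)  nothing  = tick tt ◅ tick tt ◅ ε
rewind-cell (just true)  (just _) = tick tt ◅ tick tt ◅ ε
rewind-cell (just false) nothing  = tick tt ◅ tick tt ◅ ε
rewind-cell (just false) (just _) = tick tt ◅ tick tt ◅ ε

rewind-all : ∀ cs d {l t} →
  live (onto cs (cell d ∷ l)) rewind (prog [] t) ↦* live (cell d ∷ l) rewind (prog cs t)
rewind-all []       d = ε
rewind-all (c ∷ cs) d = rewind-all cs c ◅◅ rewind-cell c d

sentinel : List Passive
sentinel = bit true ∷ bit true ∷ []

-- The blank beyond the outer 1 stops the head there; between the two 1s it becomes `next` and
-- passes back over the inner one.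
turn : ∀ {cs t} → live sentinel rewind (prog cs t) ↦* live sentinel next (prog cs t)
turn = tick tt ◅ tick tt ◅ tick tt ◅ ε

-- A step of the head computes to the desired snapshot only once the nearest cell on its left is
-- exposed.
onto-cons : ∀ cs a l → ∃[ a′ ] ∃[ l′ ] onto cs (a ∷ l) ≡ a′ ∷ l′
onto-cons []       a l = a , l , refl
onto-cons (c ∷ cs) a l = onto-cons cs (cell c) (slot ∷ a ∷ l)

-- At the double slot the head turns to `rewind`, runs back over the program without changing it,
-- and is sent out again by the sentinel. That at least one step is made will matter for
-- non-halting.
cycle : ∀ {cs t t′} → Exec cs t t′ → live sentinel next (prog cs t) ↦⁺ live sentinel next (prog cs t′)
cycle {cs} {t} {t′} ex with onto-cons cs (bit true) (bit true ∷ [])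
... | a , l , eq = execute (just true) (bit true ∷ []) ex ◅◅⁺ (_ ,
  subst (λ k → live k next (prog [] t′) ↦ live (mark ∷ k) rewind (slot ∷ t′)) (sym eq) (tick tt) ,
  subst (λ k → live (mark ∷ k) rewind (slot ∷ t′) ↦* live k rewind (prog [] t′)) (sym eq) (tick tt ◅ ε)
  ◅◅ rewind-all cs (just true) ◅◅ turn {cs})

-- Tag systems as programs

lines : List (List Bool) → List Letter
lines []       = []
lines (w ∷ ws) = nothing ∷ map just w ++ lines ws

skip-word : ∀ w {g v} → Exec (map just w) (closed g v) (closed g v)
skip-word []      = []
skip-word (b ∷ w) {g} {v} = write-closed b g v ∷ skip-word w {g} {v}

write-word : ∀ w {g c v} → Exec (map just w) (opened g (c ∷ v)) (opened g (c ∷ v ++ w))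
write-word []      {g} {c} {v} = subst (Exec [] _) (cong (λ u → opened g (c ∷ u)) (sym (++-identityʳ v))) []
write-word (b ∷ w) {g} {c} {v} = write-opened b g c v ∷
  subst (Exec _ _) (cong (λ u → opened g (c ∷ u)) (++-assoc v (b ∷ []) w)) (write-word w {g} {c} {v ++ b ∷ []})

skip-lines : ∀ ws {g v} → ∃[ h ] Exec (lines ws) (closed g (map (λ _ → false) ws ++ v)) (closed h v)
skip-lines []       {g} = g , []
skip-lines (w ∷ ws) {g} {v} with skip-lines ws {suc g} {v}
... | h , ex = h , read-closed-false g (map (λ _ → false) ws ++ v) ∷ skip-word w {suc g} {map (λ _ → false) ws ++ v} ++ₑ ex

skip-opened : ∀ w ws {g v} →
  ∃[ h ] Exec (lines (w ∷ ws)) (opened g (false ∷ map (λ _ → false) ws ++ v)) (closed h v)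
skip-opened w ws {g} {v} with skip-lines ws {g} {v}
... | h , ex = h , read-opened-false g u ∷ skip-word w {g} {u} ++ₑ ex
  where
  u = map (λ _ → false) ws ++ v

-- There are `n + 1` bits: thanks to the extra 0 at the end, every 1 is followed by a 0, and the
-- queue is closed again after each letter.
oneHot : ∀ {n} → Fin n → List Bool
oneHot {suc n} zero    = true ∷ false ∷ replicate n false
oneHot         (suc a) = false ∷ oneHot a

-- The empty line at the end reads the extra 0 of the one-hot code.
table : ∀ {n} → (Fin n → List Bool) → List (List Bool)
table f = tabulate f ++ [] ∷ []

table-suc : ∀ {n} (f : Fin n → List Bool) →
            ∃[ w ] ∃[ ws ] table f ≡ w ∷ ws × map (λ _ → false) ws ≡ replicate n false
table-suc {zero}  f = [] , [] , refl , refl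
table-suc {suc n} f with table-suc (f ∘ suc)
... | w , ws , eq , len = f zero , table (f ∘ suc) , refl , trans (cong (map _) eq) (cong (false ∷_) len)

-- The lines before the 1 read a 0 and are skipped; the line that reads the 1 carries the production
-- of `a`; the next 0 closes the queue, and the remaining lines are skipped as well.
consume : ∀ {n} (f : Fin n → List Bool) a g v →
          ∃[ h ] Exec (lines (table f)) (closed g (oneHot a ++ v)) (closed h (v ++ f a))
consume {suc n} f zero g v with table-suc (f ∘ suc)
... | w , ws , eq , len with skip-opened w ws {2 + g} {v ++ f zero}
... | h , ex = h , read-closed-true g u ∷ write-word (f zero) {2 + g} {false} {u} ++ₑ
  subst (λ z → Exec (lines z) (opened (2 + g) (false ∷ u ++ f zero)) (closed h (v ++ f zero))) (sym eq)
    (subst (λ z → Exec (lines (w ∷ ws)) (opened (2 + g) (false ∷ z)) (closed h (v ++ f zero)))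
       (trans (cong (_++ v ++ f zero) len) (sym (++-assoc (replicate n false) v (f zero)))) ex)
  where
  u = replicate n false ++ v
consume f (suc a) g v with consume (f ∘ suc) a (suc g) v
... | h , ex = h , read-closed-false g (oneHot a ++ v) ∷ skip-word (f zero) {suc g} {oneHot a ++ v} ++ₑ ex

lines-++ : ∀ ws us → lines (ws ++ us) ≡ lines ws ++ lines us
lines-++ []       us = refl
lines-++ (w ∷ ws) us = cong (nothing ∷_) (trans (cong (map just w ++_) (lines-++ ws us))
                                                (sym (++-assoc (map just w) (lines ws) (lines us))))

codes : ∀ {n} → List (Fin n) → List Bool
codes = concatMap oneHot

-- One table reads one letter. Only the first table has productions, and the `k` others merely
-- delete, which gives deletion number `k + 1`.
program : ∀ {n} → ℕ → (Fin n → List Bool) → List Letter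
program {n} k f = lines (table f ++ concat (replicate k (table {n} (λ _ → []))))

discard : ∀ {n} (d : List (Fin n)) g v →
  ∃[ h ] Exec (lines (concat (replicate (length d) (table {n} (λ _ → []))))) (closed g (codes d ++ v)) (closed h v)
discard []      g v = g , []
discard {n} (a ∷ d) g v with consume (λ _ → []) a g (codes d ++ v)
... | i , ex with discard d i v
... | h , ex′ = h , subst₂ (λ p z → Exec p (closed g z) (closed h v))
  (sym (lines-++ (table {n} (λ _ → [])) (concat (replicate (length d) (table {n} (λ _ → []))))))
  (sym (++-assoc (oneHot a) (codes d) v))
  (subst (λ z → Exec (lines (table {n} (λ _ → []))) (closed g (oneHot a ++ codes d ++ v)) (closed i z))
         (++-identityʳ (codes d ++ v)) ex ++ₑ ex′)

tag-exec : ∀ {n} (f : Fin n → List Bool) a d g v →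
  ∃[ h ] Exec (program (length d) f) (closed g (codes (a ∷ d) ++ v)) (closed h (v ++ f a))
tag-exec {n} f a d g v with consume f a g (codes d ++ v)
... | i , ex with discard d i (v ++ f a)
... | h , ex′ = h , subst₂ (λ p z → Exec p (closed g z) (closed h (v ++ f a)))
  (sym (lines-++ (table f) (concat (replicate (length d) (table {n} (λ _ → []))))))
  (sym (++-assoc (oneHot a) (codes d) v))
  (subst (λ z → Exec (lines (table f)) (closed g (oneHot a ++ codes d ++ v)) (closed i z))
         (++-assoc (codes d) v (f a)) ex ++ₑ ex′)

tag-cycle : ∀ {n} k (f : Fin n → List Bool) a d g v → length d ≡ k →
  ∃[ h ] live sentinel next (prog (program k f) (closed g (codes (a ∷ d) ++ v))) ↦⁺
         live sentinel next (prog (program k f) (closed h (v ++ f a)))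
tag-cycle k f a d g v refl with tag-exec f a d g v
... | h , ex = h , cycle ex

-- The absorption of the head, with the number of 1s

ones : List Passive → ℕ
ones []              = 0
ones (bit true ∷ w)  = suc (ones w)
ones (_ ∷ w)         = ones w

-- These are the 1s that the program itself contributes to the final count.
marks : List Letter → ℕ
marks []              = 0
marks (just true ∷ w) = suc (marks w)
marks (_ ∷ w)         = marks w

ones-cell : ∀ c cs l {n} → ones l ≡ n → ones (cell c ∷ l) + marks cs ≡ n + marks (c ∷ cs)
ones-cell nothing      cs l refl = refl
ones-cell (just true)  cs l refl = sym (+-suc (ones l) (marks cs))
ones-cell (just false) cs l refl = refl

-- This is the outward half of `through`, for a head that will not come back; it records the 1s left
-- behind.
outward : ∀ c d cs {t a} l → Seam a →
  ∃[ l′ ] live (a ∷ l) (emit c) (cell d ∷ prog cs t) ↦* live (slot ∷ slot ∷ l′) (emit c) t ×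
          ones l′ ≡ ones l + marks (d ∷ cs)
outward c d [] {t} {a} l sa = cell d ∷ a ∷ l , emit-cell c d sa ◅ emit-slot c ◅ emit-slot c ◅ ε ,
  trans (sym (+-identityʳ _)) (ones-cell d [] (a ∷ l) (seam sa))
  where
  seam : ∀ {a} → Seam a → ones (a ∷ l) ≡ ones l
  seam slot = refl
  seam mark = refl
outward c d (e ∷ cs) {t} {a} l sa with outward c e cs {t} (cell d ∷ a ∷ l) slot
... | l′ , run , eq = l′ , emit-cell c d sa ◅ emit-slot c ◅ run ,
  trans eq (ones-cell d (e ∷ cs) (a ∷ l) (seam sa))
  where
  seam : ∀ {a} → Seam a → ones (a ∷ l) ≡ ones l
  seam slot = refl
  seam mark = refl

outward-slots : ∀ c g {a l t} →
  live (a ∷ l) (emit c) (replicate g slot ++ t) ↦* live (replicate g slot ++ a ∷ l) (emit c) t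
outward-slots c zero    = ε
outward-slots c (suc g) {a} {l} {t} = emit-slot c ◅
  subst (λ k → live (slot ∷ a ∷ l) (emit c) (replicate g slot ++ t) ↦* live k (emit c) t)
    (replicate-shift g (a ∷ l)) (outward-slots c g)

ones-slots : ∀ g l → ones (replicate g slot ++ l) ≡ ones l
ones-slots zero    l = refl
ones-slots (suc g) l = ones-slots g l

-- The 3 stands for the two 1s at the front of the queue and the cell of the head, which becomes a 1
-- as well.
freeze-slots : ∀ g l v →
  ∃[ l′ ] ∃[ r ] live (slot ∷ l) read (closed g (true ∷ true ∷ v)) ↦* dead l′ r ×
                 ones l′ + ones r ≡ 3 + ones (map bit v) + ones l
freeze-slots g l v = _ , _ , outward-slots nothing g ◅◅ frozen (replicate g slot ++ slot ∷ l) (fits g)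
  , count
  where
  fits : ∀ g → ∃[ k ] replicate g slot ++ slot ∷ l ≡ slot ∷ k
  fits zero    = l , refl
  fits (suc g) = replicate g slot ++ slot ∷ l , refl
  frozen : ∀ k → ∃[ j ] k ≡ slot ∷ j → live k read (mark ∷ bit true ∷ bit true ∷ map bit v) ↦*
             dead (slot ∷ k) (bit true ∷ bit true ∷ bit true ∷ map bit v)
  frozen _ (j , refl) = tick tt ◅ tick tt ◅ ε
  count : ones (slot ∷ replicate g slot ++ slot ∷ l) + (3 + ones (map bit v)) ≡ 3 + ones (map bit v) + ones l
  count = trans (+-comm (ones (replicate g slot ++ slot ∷ l)) _) (cong (3 + ones (map bit v) +_) (ones-slots g (slot ∷ l)))

-- The two 1s of the sentinel are added to the three of `freeze-slots`.
freeze : ∀ cs g v →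
  ∃[ l ] ∃[ r ] live sentinel next (prog (nothing ∷ cs) (closed g (true ∷ true ∷ v))) ↦* dead l r ×
                ones l + ones r ≡ 5 + marks cs + ones (map bit v)
freeze cs g v with outward nothing nothing cs {closed g (true ∷ true ∷ v)} sentinel mark
... | l , run , eq with freeze-slots g (slot ∷ l) v
... | l′ , r , run′ , eq′ = l′ , r , emit-next nothing ◅ run ◅◅ run′ , trans eq′ (trans (cong (3 + ones (map bit v) +_) eq)
  (solve 2 (λ m o → con 3 :+ o :+ (con 2 :+ m) := con 5 :+ m :+ o) refl (marks cs) (ones (map bit v))))
  where open +-*-Solver

-- Tag systems

codes-++ : ∀ {n} (u v : List (Fin n)) → codes (u ++ v) ≡ codes u ++ codes v
codes-++ = concatMap-++ oneHot

copies : ∀ {A : Set} → ℕ → List A → List A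
copies n b = concat (replicate n b)

copies-+ : ∀ {A : Set} m n (b : List A) → copies (m + n) b ≡ copies m b ++ copies n b
copies-+ zero    n b = refl
copies-+ (suc m) n b = trans (cong (b ++_) (copies-+ m n b)) (sym (++-assoc b (copies m b) (copies n b)))

copies-* : ∀ {A : Set} m n (b : List A) → copies (m * n) b ≡ copies m (copies n b)
copies-* zero    n b = refl
copies-* (suc m) n b = trans (copies-+ n (m * n) b) (cong (copies n b ++_) (copies-* m n b))

copies-[] : ∀ {A : Set} n → copies {A} n [] ≡ []
copies-[] zero    = refl
copies-[] (suc n) = copies-[] n

copies-singleton : ∀ {A : Set} n (a : A) → copies n [ a ] ≡ replicate n a
copies-singleton zero    a = refl
copies-singleton (suc n) a = cong (a ∷_) (copies-singleton n a)

copies-replicate : ∀ {A : Set} m n (a : A) → copies m (replicate n a) ≡ replicate (m * n) a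
copies-replicate m n a = trans (cong (copies m) (sym (copies-singleton n a)))
  (trans (sym (copies-* m n [ a ])) (copies-singleton (m * n) a))

codes-copies : ∀ {n} m (b : List (Fin n)) → codes (copies m b) ≡ copies m (codes b)
codes-copies zero    b = refl
codes-copies (suc m) b = trans (codes-++ b (copies m b)) (cong (codes b ++_) (codes-copies m b))

concatMap-replicate : ∀ {A B : Set} (f : A → List B) n a → concatMap f (replicate n a) ≡ copies n (f a)
concatMap-replicate f n a = cong concat (map-replicate f n a)

drop-++ˡ : ∀ {A : Set} n (u v : List A) → n ≤ length u → drop n (u ++ v) ≡ drop n u ++ v
drop-++ˡ zero    u       v _       = refl
drop-++ˡ (suc n) (_ ∷ u) v (s≤s p) = drop-++ˡ n u v p

drop-replicate : ∀ {A : Set} n (a : A) → drop n (replicate n a) ≡ []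
drop-replicate zero    a = refl
drop-replicate (suc n) a = drop-replicate n a

-- The deletion number is `k + 1`. Productions are words of bits, because the halting word begins
-- with two 1s and so is not the code of any word of letters.
module Tag {n} (k : ℕ) (prod : Fin n → List Bool) where

  infix 4 _⟶_ _⟶*_

  data _⟶_ : List Bool → List Bool → Set where
    tag : ∀ a d r → length d ≡ k → codes (a ∷ d) ++ r ⟶ r ++ prod a

  _⟶*_ : List Bool → List Bool → Set
  _⟶*_ = Star _⟶_

  infixr 5 _≡◅_
  _≡◅_ : ∀ {u v w} → u ≡ v → v ⟶* w → u ⟶* w
  refl ≡◅ run = run

  -- A block is as wide as the deletion number, so exactly one of its letters is read and the offset
  -- carries over to the next block.
  record Reads (o : ℕ) (b : List (Fin n)) (a : Fin n) : Set where
    field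
      width : length b ≡ suc k
      at    : drop o b ≡ a ∷ drop (suc o) b

  -- Along with `a` go the `k - o` letters behind it in the block and the first `o` letters of `t`;
  -- hence `t` is again read at offset `o`.
  block-step : ∀ {o b a} → o ≤ k → Reads o b a → ∀ t r → o ≤ length t →
               codes (drop o (b ++ t)) ++ r ⟶ codes (drop o t) ++ r ++ prod a
  block-step {o} {b} {a} o≤k reads t r o≤t =
    subst₂ _⟶_ from (++-assoc (codes (drop o t)) r (prod a)) (tag a d (codes (drop o t) ++ r) len)
    where
    open Reads reads
    d = drop (suc o) b ++ take o t
    len : length d ≡ k
    len = begin
      length d                               ≡⟨ length-++ (drop (suc o) b) ⟩
      length (drop (suc o) b) + length (take o t) ≡⟨ cong₂ _+_ (length-drop (suc o) b) (length-take o t) ⟩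
      (length b ∸ suc o) + (o ⊓ length t) ≡⟨ cong₂ (λ x y → (x ∸ suc o) + y) width (m≤n⇒m⊓n≡m o≤t) ⟩
      (k ∸ o) + o                            ≡⟨ m∸n+n≡m o≤k ⟩
      k                                      ∎
      where open ≡-Reasoning
    from : codes (a ∷ d) ++ codes (drop o t) ++ r ≡ codes (drop o (b ++ t)) ++ r
    from = begin
      codes (a ∷ d) ++ codes (drop o t) ++ r   ≡⟨ sym (++-assoc (codes (a ∷ d)) _ r) ⟩
      (codes (a ∷ d) ++ codes (drop o t)) ++ r ≡⟨ cong (_++ r) (sym (codes-++ (a ∷ d) (drop o t))) ⟩
      codes (a ∷ d ++ drop o t) ++ r           ≡⟨ cong (λ z → codes (a ∷ z) ++ r)
                                                    (trans (++-assoc (drop (suc o) b) _ _) (cong (drop (suc o) b ++_) (take++drop≡id o t))) ⟩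
      codes (a ∷ drop (suc o) b ++ t) ++ r     ≡⟨ cong (λ z → codes (z ++ t) ++ r) (sym at) ⟩
      codes (drop o b ++ t) ++ r
        ≡⟨ cong (λ z → codes z ++ r) (sym (drop-++ˡ o b t (≤-trans (m≤n⇒m≤1+n o≤k) (≤-reflexive (sym width))))) ⟩
      codes (drop o (b ++ t)) ++ r             ∎
      where open ≡-Reasoning

  data Blocks (o : ℕ) : List (Fin n) → List (Fin n) → Set where
    []  : Blocks o [] []
    _∷_ : ∀ {b a w as} → Reads o b a → Blocks o w as → Blocks o (b ++ w) (a ∷ as)

  infixr 5 _++ᵇ_
  _++ᵇ_ : ∀ {o v as w bs} → Blocks o v as → Blocks o w bs → Blocks o (v ++ w) (as ++ bs)
  [] ++ᵇ bs = bs
  _++ᵇ_ {w = w} (_∷_ {b} {a} {v} {as} r rs) bs =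
    subst (λ z → Blocks _ z (a ∷ as ++ _)) (sym (++-assoc b v w)) (r ∷ (rs ++ᵇ bs))

  blocks-copies : ∀ {o b a} → Reads o b a → ∀ m → Blocks o (copies m b) (replicate m a)
  blocks-copies r zero    = []
  blocks-copies r (suc m) = r ∷ blocks-copies r m

  -- The word `e` supplies the `o` letters that the last step deletes beyond the last block.
  pass : ∀ {o w as} → o ≤ k → Blocks o w as → ∀ e r → o ≤ length e →
         codes (drop o (w ++ e)) ++ r ⟶* codes (drop o e) ++ r ++ concatMap prod as
  pass {o} o≤k [] e r _ = cong (codes (drop o e) ++_) (sym (++-identityʳ r)) ≡◅ ε
  pass {o} o≤k (_∷_ {b} {a} {w} {as} rd rds) e r o≤e =
    cong (λ z → codes (drop o z) ++ r) (++-assoc b w e) ≡◅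
    block-step o≤k rd (w ++ e) r (≤-trans o≤e (≤-trans (m≤n+m (length e) (length w)) (≤-reflexive (sym (length-++ w))))) ◅
    (pass o≤k rds e (r ++ prod a) o≤e ◅◅
     (cong (codes (drop o e) ++_) (++-assoc r (prod a) (concatMap prod as)) ≡◅ ε))

  reads-uniform : ∀ {o} a → o ≤ k → Reads o (replicate (suc k) a) a
  reads-uniform {o} a o≤k = record { width = length-replicate (suc k) ; at = go o k o≤k }
    where
    go : ∀ o m → o ≤ m → drop o (replicate (suc m) a) ≡ a ∷ drop (suc o) (replicate (suc m) a)
    go zero    m       _       = refl
    go (suc o) (suc m) (s≤s p) = go o m p

  prods-copies : ∀ {a} (w : List (Fin n)) → prod a ≡ codes w → ∀ m → concatMap prod (replicate m a) ≡ codes (copies m w)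
  prods-copies {a} w eq m = trans (concatMap-replicate prod m a) (trans (cong (copies m) eq) (sym (codes-copies m w)))

  -- Reading a run of length m (k + 1) + j + 1 divides it by k + 1, and leaves
  -- the remainder j in the offset at which the following word is read.
  divide : ∀ {a b} u v → prod a ≡ codes u → prod b ≡ codes v → ∀ m j t → j ≤ k → k ∸ j ≤ length t →
           codes (a ∷ replicate (j + m * suc k) b) ++ codes t ⟶* codes (drop (k ∸ j) (t ++ u ++ copies m v))
  divide {a} {b} u v eq eq′ zero j t j≤k le =
    from ≡◅ tag a d (codes (drop (k ∸ j) t)) len ◅ (to ≡◅ ε)
    where
    open ≡-Reasoning
    d = replicate j b ++ take (k ∸ j) t
    len : length d ≡ k
    len = begin
      length d ≡⟨ length-++ (replicate j b) ⟩
      length (replicate j b) + length (take (k ∸ j) t) ≡⟨ cong₂ _+_ (length-replicate j) (length-take (k ∸ j) t) ⟩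
      j + ((k ∸ j) ⊓ length t) ≡⟨ cong (j +_) (m≤n⇒m⊓n≡m le) ⟩
      j + (k ∸ j) ≡⟨ m+[n∸m]≡n j≤k ⟩
      k ∎
    from : codes (a ∷ replicate (j + 0) b) ++ codes t ≡ codes (a ∷ d) ++ codes (drop (k ∸ j) t)
    from = begin
      codes (a ∷ replicate (j + 0) b) ++ codes t ≡⟨ cong (λ i → codes (a ∷ replicate i b) ++ codes t) (+-identityʳ j) ⟩
      codes (a ∷ replicate j b) ++ codes t       ≡⟨ sym (codes-++ (a ∷ replicate j b) t) ⟩
      codes (a ∷ replicate j b ++ t)
        ≡⟨ cong (λ z → codes (a ∷ replicate j b ++ z)) (sym (take++drop≡id (k ∸ j) t)) ⟩
      codes (a ∷ replicate j b ++ take (k ∸ j) t ++ drop (k ∸ j) t)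
        ≡⟨ cong (λ z → codes (a ∷ z)) (sym (++-assoc (replicate j b) _ _)) ⟩
      codes (a ∷ d ++ drop (k ∸ j) t)            ≡⟨ codes-++ (a ∷ d) (drop (k ∸ j) t) ⟩
      codes (a ∷ d) ++ codes (drop (k ∸ j) t)    ∎
    to : codes (drop (k ∸ j) t) ++ prod a ≡ codes (drop (k ∸ j) (t ++ u ++ []))
    to = begin
      codes (drop (k ∸ j) t) ++ prod a       ≡⟨ cong (codes (drop (k ∸ j) t) ++_) eq ⟩
      codes (drop (k ∸ j) t) ++ codes u      ≡⟨ sym (codes-++ (drop (k ∸ j) t) u) ⟩
      codes (drop (k ∸ j) t ++ u)            ≡⟨ cong codes (sym (drop-++ˡ (k ∸ j) t u le)) ⟩
      codes (drop (k ∸ j) (t ++ u))          ≡⟨ cong (λ z → codes (drop (k ∸ j) (t ++ z))) (sym (++-identityʳ u)) ⟩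
      codes (drop (k ∸ j) (t ++ u ++ []))    ∎
  divide {a} {b} u v eq eq′ (suc m) j t j≤k le =
    from ≡◅ tag a (replicate k b) _ (length-replicate k) ◅
    -- What is left of the run begins with a `b`, so in the recursive call `b` takes the place of
    -- `a` and `v` that of `u`, while `u` has moved behind `t`.
    mid ≡◅ (divide v v eq′ eq′ m j (t ++ u) j≤k (≤-trans le (≤-trans (m≤m+n (length t) (length u)) (≤-reflexive (sym (length-++ t)))))
    ◅◅ (cong (λ z → codes (drop (k ∸ j) z)) (++-assoc t u (v ++ copies m v)) ≡◅ ε))
    where
    open ≡-Reasoning
    w = b ∷ replicate (j + m * suc k) b
    run : j + suc m * suc k ≡ k + suc (j + m * suc k)
    run = begin
      j + suc (k + m * suc k)   ≡⟨ +-suc j _ ⟩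
      suc (j + (k + m * suc k))
        ≡⟨ cong suc (trans (sym (+-assoc j k _)) (trans (cong (_+ m * suc k) (+-comm j k)) (+-assoc k j _))) ⟩
      suc (k + (j + m * suc k)) ≡⟨ sym (+-suc k _) ⟩
      k + suc (j + m * suc k)   ∎
    replicate-++ : ∀ i l → replicate (i + l) b ≡ replicate i b ++ replicate l b
    replicate-++ zero    l = refl
    replicate-++ (suc i) l = cong (b ∷_) (replicate-++ i l)
    from : codes (a ∷ replicate (j + suc m * suc k) b) ++ codes t ≡ codes (a ∷ replicate k b) ++ codes w ++ codes t
    from = begin
      codes (a ∷ replicate (j + suc m * suc k) b) ++ codes t
        ≡⟨ cong (λ z → codes (a ∷ z) ++ codes t) (trans (cong (λ i → replicate i b) run) (replicate-++ k _)) ⟩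
      codes (a ∷ replicate k b ++ w) ++ codes t ≡⟨ cong (_++ codes t) (codes-++ (a ∷ replicate k b) w) ⟩
      (codes (a ∷ replicate k b) ++ codes w) ++ codes t ≡⟨ ++-assoc (codes (a ∷ replicate k b)) (codes w) (codes t) ⟩
      codes (a ∷ replicate k b) ++ codes w ++ codes t ∎
    mid : (codes w ++ codes t) ++ prod a ≡ codes w ++ codes (t ++ u)
    mid = trans (++-assoc (codes w) (codes t) (prod a)) (cong (codes w ++_) (trans (cong (codes t ++_) eq) (sym (codes-++ t u))))

-- Turing machines as tag systems

drop-tabulate : ∀ {A : Set} {m} (f : Fin m → A) i →
                drop (toℕ i) (tabulate f) ≡ f i ∷ drop (suc (toℕ i)) (tabulate f)
drop-tabulate f zero    = refl
drop-tabulate f (suc i) = drop-tabulate (λ j → f (suc j)) i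

-- An anchor marks the beginning of the run of units that follows it.
data Kind : Set where
  anchorˡ unitˡ anchorʳ unitʳ : Kind

kind : Kind → Fin 4
kind anchorˡ = 0F
kind unitˡ   = 1F
kind anchorʳ = 2F
kind unitʳ   = 3F

kind⁻¹ : Fin 4 → Kind
kind⁻¹ 0F = anchorˡ
kind⁻¹ 1F = unitˡ
kind⁻¹ 2F = anchorʳ
kind⁻¹ 3F = unitʳ

kind⁻¹-kind : ∀ κ → kind⁻¹ (kind κ) ≡ κ
kind⁻¹-kind anchorˡ = refl
kind⁻¹-kind unitˡ   = refl
kind⁻¹-kind anchorʳ = refl
kind⁻¹-kind unitʳ   = refl

module Simulation (M : TuringMachine) where
  open TuringMachine M

  data Glyph : Set where
    padding tally : Glyph
    plain         : Kind → Fin states → Glyph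
    phased        : Kind → Fin states → Fin (suc k) → Glyph

  size : ℕ
  size = 2 + (states * 4 + states * suc k * 4)

  abstract
    encode : Glyph → Fin size
    encode padding        = 0F
    encode tally          = 1F
    encode (plain κ s)    = suc (suc (combine s (kind κ) ↑ˡ _))
    encode (phased κ s o) = suc (suc ((states * 4) ↑ʳ combine (combine s o) (kind κ)))

    plain⁻¹ : Fin states × Fin 4 → Glyph
    plain⁻¹ (s , κ) = plain (kind⁻¹ κ) s

    phased⁻¹ : Fin (states * suc k) × Fin 4 → Glyph
    phased⁻¹ (so , κ) = phased (kind⁻¹ κ) (proj₁ (remQuot {states} (suc k) so)) (proj₂ (remQuot {states} (suc k) so))

    decode : Fin size → Glyph
    decode zero          = padding
    decode (suc zero)    = tally
    decode (suc (suc i)) =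
      [ (λ j → plain⁻¹ (remQuot 4 j)) , (λ j → phased⁻¹ (remQuot 4 j)) ]′ (splitAt (states * 4) i)

    decode-encode : ∀ g → decode (encode g) ≡ g
    decode-encode padding = refl
    decode-encode tally   = refl
    decode-encode (plain κ s) =
      trans (cong [ _ , _ ]′ (splitAt-↑ˡ (states * 4) (combine s (kind κ)) (states * suc k * 4)))
      (trans (cong plain⁻¹ (remQuot-combine s (kind κ))) (cong (λ z → plain z s) (kind⁻¹-kind κ)))
    decode-encode (phased κ s o) =
      trans (cong [ _ , _ ]′ (splitAt-↑ʳ (states * 4) (states * suc k * 4) (combine (combine s o) (kind κ))))
      (trans (cong phased⁻¹ (remQuot-combine (combine s o) (kind κ)))
      (cong₂ (λ κ′ so → phased κ′ (proj₁ so) (proj₂ so)) (kind⁻¹-kind κ) (remQuot-combine s o)))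

  Text : Set
  Text = List (Fin size)

  -- Being constant, such a block is read alike at whatever offset the division of the other half of
  -- the tape leaves behind.
  uniform : Kind → Fin states → Text
  uniform κ s = replicate (suc k) (encode (plain κ s))

  -- The letter at position `o` knows `o`; so reading at an offset hands the scanned symbol, which
  -- is `opposite o`, to the production.
  block : Kind → Fin states → Text
  block κ s = tabulate (λ o → encode (phased κ s o))

  skips : ℕ → Text
  skips o = replicate o (encode padding)

  tallies : ℕ → Text
  tallies m = replicate m (encode tally)

  -- What a letter of a phased block contributes if it is read at offset o.  The
  -- padding compensates for the offset, so that the next pass starts aligned.
  anchorˡ-text unitˡ-text anchorʳ-text unitʳ-text : Maybe (Fin states × Symbol × Direction) → List Bool
  anchorˡ-text nothing                = []
  anchorˡ-text (just (s , a , left))  = codes [ encode (plain anchorˡ s) ]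
  anchorˡ-text (just (s , a , right)) = codes (uniform anchorˡ s ++ copies (toℕ a) (uniform unitˡ s))
  unitˡ-text nothing                = []
  unitˡ-text (just (s , a , left))  = codes [ encode (plain unitˡ s) ]
  unitˡ-text (just (s , a , right)) = codes (copies (suc k) (uniform unitˡ s))
  anchorʳ-text nothing                = []
  anchorʳ-text (just (s , a , left))  = codes (uniform anchorʳ s ++ copies (toℕ a) (uniform unitʳ s))
  anchorʳ-text (just (s , a , right)) = codes [ encode (plain anchorʳ s) ]
  unitʳ-text nothing                = codes (tallies (suc k))
  unitʳ-text (just (s , a , left))  = codes (copies (suc k) (uniform unitʳ s))
  unitʳ-text (just (s , a , right)) = codes [ encode (plain unitʳ s) ]

  -- The two 1s absorb the head. Together with `k + 1` tallies from each unit of the right half, the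
  -- tallies add up to the number of the tape from the head onwards.
  halting-text : Maybe (Fin states × Symbol × Direction) → Symbol → List Bool
  halting-text nothing  j = true ∷ true ∷ codes (tallies (toℕ j))
  halting-text (just _) j = []

  production : Glyph → List Bool
  production padding              = []
  production tally                = []
  production (plain κ s)          = codes (block κ s)
  production (phased anchorˡ s o) = codes (skips (toℕ o)) ++ halting-text (δ s (opposite o)) (opposite o)
                                    ++ anchorˡ-text (δ s (opposite o))
  production (phased unitˡ s o)   = unitˡ-text (δ s (opposite o))
  production (phased anchorʳ s o) = anchorʳ-text (δ s (opposite o))
  production (phased unitʳ s o)   = unitʳ-text (δ s (opposite o))

  prod : Fin size → List Bool
  prod i = production (decode i)

  prod-encode : ∀ g → prod (encode g) ≡ production g
  prod-encode g = cong production (decode-encode g)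

  open Tag k prod public

  reads-block : ∀ κ s o → Reads (toℕ o) (block κ s) (encode (phased κ s o))
  reads-block κ s o = record { width = length-tabulate (λ o → encode (phased κ s o)) ; at = drop-tabulate (λ o → encode (phased κ s o)) o }

  -- The two passes of a machine step

  units : Fin states → Symbol → ℕ → ℕ → Text
  units s j m n = copies m (block unitˡ s) ++ block anchorʳ s ++ copies n (block unitʳ s)

  -- Here `m` and `n` are the two halves of the tape in base `k + 1`, and the scanned symbol `j` is
  -- kept as the offset: `k - j` letters of the first block are missing.
  standard : Fin states → ℕ → Symbol → ℕ → List Bool
  standard s m j n = codes (drop (k ∸ toℕ j) (block anchorˡ s ++ units s j m n))

  offset≤ : ∀ {o : Symbol} → toℕ o ≤ k
  offset≤ {o} = ≤-pred (toℕ<n o)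

  after-anchor : Fin states → Symbol → ℕ → ℕ → List Bool
  after-anchor s j m n = halting-text (δ s j) j ++ anchorˡ-text (δ s j) ++
    copies m (unitˡ-text (δ s j)) ++ anchorʳ-text (δ s j) ++ copies n (unitʳ-text (δ s j))

  -- All blocks are read at offset `k - j`, so every production consults `δ s j`. The padding from
  -- the left anchor is used up at the end of the pass, and what follows it starts aligned. The
  -- first step is split off to show that time passes.
  first-pass : ∀ s m j n → ∃[ w ] standard s m j n ⟶ w × w ⟶* after-anchor s j m n
  first-pass s m j n = _ , subst (λ i → codes (drop i (block anchorˡ s ++ t)) ⟶ codes (drop (toℕ o) t) ++ prod p) o-prop begin′ , rest′
    where
    o = opposite j
    o-prop : toℕ o ≡ k ∸ toℕ j
    o-prop = opposite-prop j
    j-prop : opposite o ≡ j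
    j-prop = opposite-involutive j
    t = units s j m n
    e = skips (toℕ o)
    p = encode (phased anchorˡ s o)
    A = halting-text (δ s j) j ++ anchorˡ-text (δ s j)
    long : toℕ o ≤ length t
    long = ≤-trans (offset≤ {o}) (≤-trans (n≤1+n k) (≤-trans (≤-reflexive (sym (length-tabulate (λ o → encode (phased anchorʳ s o)))))
      (≤-trans (m≤m+n (length (block anchorʳ s)) (length (copies n (block unitʳ s))))
      (≤-trans (≤-reflexive (sym (length-++ (block anchorʳ s)))) (≤-trans (m≤n+m _ (length (copies m (block unitˡ s))))
      (≤-reflexive (sym (length-++ (copies m (block unitˡ s))))))))))
    begin′ : codes (drop (toℕ o) (block anchorˡ s ++ t)) ⟶ codes (drop (toℕ o) t) ++ prod p
    begin′ = subst (λ z → z ⟶ codes (drop (toℕ o) t) ++ prod p) (++-identityʳ _)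
               (block-step (offset≤ {o}) (reads-block anchorˡ s o) t [] long)
    prod-p : prod p ≡ codes e ++ A
    prod-p = trans (prod-encode (phased anchorˡ s o)) (cong (λ i → codes e ++ halting-text (δ s i) i ++ anchorˡ-text (δ s i)) j-prop)
    as = replicate m (encode (phased unitˡ s o)) ++ encode (phased anchorʳ s o) ∷ replicate n (encode (phased unitʳ s o))
    blocks : Blocks (toℕ o) t as
    blocks = blocks-copies (reads-block unitˡ s o) m ++ᵇ (reads-block anchorʳ s o ∷ blocks-copies (reads-block unitʳ s o) n)
    phased-prod : ∀ κ (f : Maybe (Fin states × Symbol × Direction) → List Bool) →
                  production (phased κ s o) ≡ f (δ s (opposite o)) → prod (encode (phased κ s o)) ≡ f (δ s j)
    phased-prod κ f eq = trans (prod-encode (phased κ s o)) (trans eq (cong (λ i → f (δ s i)) j-prop))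
    result : concatMap prod as ≡ copies m (unitˡ-text (δ s j)) ++ anchorʳ-text (δ s j) ++ copies n (unitʳ-text (δ s j))
    result = trans (concatMap-++ prod (replicate m (encode (phased unitˡ s o))) _) (cong₂ _++_
      (trans (concatMap-replicate prod m _) (cong (copies m) (phased-prod unitˡ unitˡ-text refl)))
      (cong₂ _++_ (phased-prod anchorʳ anchorʳ-text refl)
        (trans (concatMap-replicate prod n _) (cong (copies n) (phased-prod unitʳ unitʳ-text refl)))))
    rest′ : codes (drop (toℕ o) t) ++ prod p ⟶* after-anchor s j m n
    rest′ =
      trans (cong (codes (drop (toℕ o) t) ++_) prod-p) (trans (sym (++-assoc (codes (drop (toℕ o) t)) (codes e) A))
        (cong (_++ A) (trans (sym (codes-++ (drop (toℕ o) t) e)) (cong codes (sym (drop-++ˡ (toℕ o) t e long)))))) ≡◅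
      (pass (offset≤ {o}) blocks e A (≤-reflexive (sym (length-replicate (toℕ o))))
      ◅◅ (trans (cong (λ z → codes z ++ A ++ concatMap prod as) (drop-replicate (toℕ o) (encode padding)))
           (trans (cong (A ++_) result) (++-assoc (halting-text (δ s j) j) (anchorˡ-text (δ s j)) _)) ≡◅ ε))

  reads-plain : ∀ κ s {o} → o ≤ k → Reads o (uniform κ s) (encode (plain κ s))
  reads-plain κ s = reads-uniform (encode (plain κ s))

  long-block : ∀ κ s t j → k ∸ j ≤ length (block κ s ++ t)
  long-block κ s t j = ≤-trans (m∸n≤m k j) (≤-trans (n≤1+n k) (≤-trans
    (≤-reflexive (sym (length-tabulate (λ o → encode (phased κ s o)))))
    (≤-trans (m≤m+n (length (block κ s)) (length t)) (≤-reflexive (sym (length-++ (block κ s)))))))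

  -- The left half passes at offset 0, and then the run of the right half is divided: the quotient
  -- becomes the new right half, and the remainder, as an offset, the new scanned symbol.
  second-pass-right : ∀ s m j n →
    codes ((uniform anchorˡ s ++ copies m (uniform unitˡ s)) ++
           encode (plain anchorʳ s) ∷ replicate (toℕ j + n * suc k) (encode (plain unitʳ s))) ⟶*
    standard s m j n
  second-pass-right s m j n =
    sym (++-identityʳ _) ≡◅
    (pass z≤n (reads-plain anchorˡ s z≤n ∷ blocks-copies (reads-plain unitˡ s z≤n) m) e [] z≤n
    ◅◅ (cong (codes e ++_) result ≡◅
       (divide (block anchorʳ s) (block unitʳ s) (prod-encode (plain anchorʳ s)) (prod-encode (plain unitʳ s))
              n (toℕ j) t (offset≤ {j}) (long-block anchorˡ s _ (toℕ j))
       ◅◅ (cong (λ z → codes (drop (k ∸ toℕ j) z)) (++-assoc (block anchorˡ s) (copies m (block unitˡ s)) _) ≡◅ ε))))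
    where
    e = encode (plain anchorʳ s) ∷ replicate (toℕ j + n * suc k) (encode (plain unitʳ s))
    t = block anchorˡ s ++ copies m (block unitˡ s)
    result : concatMap prod (encode (plain anchorˡ s) ∷ replicate m (encode (plain unitˡ s))) ≡ codes t
    result = trans (cong₂ _++_ (prod-encode (plain anchorˡ s)) (prods-copies (block unitˡ s) (prod-encode (plain unitˡ s)) m))
                   (sym (codes-++ (block anchorˡ s) (copies m (block unitˡ s))))

  -- Now the division comes first. The uniform blocks of the right half are then read at offset
  -- `k - j`, and this offset is still in force when the new left half is reached.
  second-pass-left : ∀ s m j n →
    codes (encode (plain anchorˡ s) ∷ replicate (toℕ j + m * suc k) (encode (plain unitˡ s)) ++
           uniform anchorʳ s ++ copies n (uniform unitʳ s)) ⟶*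
    standard s m j n
  second-pass-left s m j n =
    codes-++ (encode (plain anchorˡ s) ∷ replicate (toℕ j + m * suc k) (encode (plain unitˡ s))) t ≡◅
    (divide (block anchorˡ s) (block unitˡ s) (prod-encode (plain anchorˡ s)) (prod-encode (plain unitˡ s))
           m (toℕ j) t (offset≤ {j}) long
    ◅◅ (sym (++-identityʳ _) ≡◅
       (pass (m∸n≤m k (toℕ j)) (reads-plain anchorʳ s (m∸n≤m k (toℕ j)) ∷ blocks-copies (reads-plain unitʳ s (m∸n≤m k (toℕ j))) n)
            e [] (long-block anchorˡ s _ (toℕ j))
       ◅◅ (final ≡◅ ε))))
    where
    t = uniform anchorʳ s ++ copies n (uniform unitʳ s)
    e = block anchorˡ s ++ copies m (block unitˡ s)
    f = block anchorʳ s ++ copies n (block unitʳ s)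
    long : k ∸ toℕ j ≤ length t
    long = ≤-trans (m∸n≤m k (toℕ j)) (≤-trans (n≤1+n k) (≤-trans (≤-reflexive (sym (length-replicate (suc k))))
      (≤-trans (m≤m+n (length (uniform anchorʳ s)) _) (≤-reflexive (sym (length-++ (uniform anchorʳ s)))))))
    result : concatMap prod (encode (plain anchorʳ s) ∷ replicate n (encode (plain unitʳ s))) ≡ codes f
    result = trans (cong₂ _++_ (prod-encode (plain anchorʳ s)) (prods-copies (block unitʳ s) (prod-encode (plain unitʳ s)) n))
                   (sym (codes-++ (block anchorʳ s) (copies n (block unitʳ s))))
    final : codes (drop (k ∸ toℕ j) e) ++ concatMap prod (encode (plain anchorʳ s) ∷ replicate n (encode (plain unitʳ s)))
            ≡ standard s m j n
    final = trans (cong (codes (drop (k ∸ toℕ j) e) ++_) result) (trans (sym (codes-++ (drop (k ∸ toℕ j) e) f))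
      (cong codes (trans (sym (drop-++ˡ (k ∸ toℕ j) e f (long-block anchorˡ s _ (toℕ j))))
        (cong (drop (k ∸ toℕ j)) (++-assoc (block anchorˡ s) (copies m (block unitˡ s)) f)))))

  halting-result : ∀ s m j n → δ s j ≡ nothing →
                   after-anchor s j m n ≡ true ∷ true ∷ codes (tallies (toℕ j + n * suc k))
  halting-result s m j n eq rewrite eq | copies-[] {Bool} m = cong (λ z → true ∷ true ∷ z) (begin
    codes (tallies (toℕ j)) ++ copies n (codes (tallies (suc k)))
      ≡⟨ cong (codes (tallies (toℕ j)) ++_) (sym (codes-copies n (tallies (suc k)))) ⟩
    codes (tallies (toℕ j)) ++ codes (copies n (tallies (suc k))) ≡⟨ sym (codes-++ (tallies (toℕ j)) _) ⟩
    codes (tallies (toℕ j) ++ copies n (tallies (suc k)))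
      ≡⟨ cong codes (cong₂ _++_ (sym (copies-singleton (toℕ j) _)) (copies-replicate n (suc k) _)) ⟩
    codes (copies (toℕ j) [ encode tally ] ++ tallies (n * suc k))
      ≡⟨ cong (λ z → codes (copies (toℕ j) [ encode tally ] ++ z)) (sym (copies-singleton (n * suc k) _)) ⟩
    codes (copies (toℕ j) [ encode tally ] ++ copies (n * suc k) [ encode tally ])
      ≡⟨ cong codes (sym (copies-+ (toℕ j) (n * suc k) _)) ⟩
    codes (copies (toℕ j + n * suc k) [ encode tally ])
      ≡⟨ cong codes (copies-singleton (toℕ j + n * suc k) _) ⟩
    codes (tallies (toℕ j + n * suc k))                            ∎)
    where open ≡-Reasoning

  -- This is how the written symbol `a` is pushed onto a half of the tape: the number is multiplied
  -- by the base, and `a` is added.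
  grow : ∀ a m (u w : Text) → codes (u ++ copies a w) ++ copies m (codes (copies (suc k) w)) ≡ codes (u ++ copies (a + m * suc k) w)
  grow a m u w = begin
    codes (u ++ copies a w) ++ copies m (codes (copies (suc k) w))
      ≡⟨ cong (codes (u ++ copies a w) ++_) (sym (codes-copies m _)) ⟩
    codes (u ++ copies a w) ++ codes (copies m (copies (suc k) w)) ≡⟨ sym (codes-++ (u ++ copies a w) _) ⟩
    codes ((u ++ copies a w) ++ copies m (copies (suc k) w))       ≡⟨ cong codes (++-assoc u _ _) ⟩
    codes (u ++ copies a w ++ copies m (copies (suc k) w))
      ≡⟨ cong (λ z → codes (u ++ copies a w ++ z)) (sym (copies-* m (suc k) w)) ⟩
    codes (u ++ copies a w ++ copies (m * suc k) w)
      ≡⟨ cong (λ z → codes (u ++ z)) (sym (copies-+ a (m * suc k) w)) ⟩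
    codes (u ++ copies (a + m * suc k) w)                          ∎
    where open ≡-Reasoning

  shrink : ∀ n a b → codes [ a ] ++ copies n (codes [ b ]) ≡ codes {size} (a ∷ replicate n b)
  shrink n a b = trans (cong (codes [ a ] ++_) (trans (sym (codes-copies n [ b ])) (cong codes (copies-singleton n b))))
                       (sym (codes-++ [ a ] (replicate n b)))

  right-result : ∀ s m j n {s′ a} → δ s j ≡ just (s′ , a , right) →
    after-anchor s j m n ≡ codes ((uniform anchorˡ s′ ++ copies (toℕ a + m * suc k) (uniform unitˡ s′)) ++
                                  encode (plain anchorʳ s′) ∷ replicate n (encode (plain unitʳ s′)))
  right-result s m j n {s′} {a} eq rewrite eq = begin
    codes u ++ copies m p ++ codes [ c ] ++ copies n (codes [ d ]) ≡⟨ sym (++-assoc (codes u) _ _) ⟩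
    (codes u ++ copies m p) ++ codes [ c ] ++ copies n (codes [ d ])
      ≡⟨ cong₂ _++_ (grow (toℕ a) m (uniform anchorˡ s′) (uniform unitˡ s′)) (shrink n c d) ⟩
    codes v ++ codes (c ∷ replicate n d) ≡⟨ sym (codes-++ v _) ⟩
    codes (v ++ c ∷ replicate n d) ∎
    where
    open ≡-Reasoning
    c = encode (plain anchorʳ s′)
    d = encode (plain unitʳ s′)
    p = codes (copies (suc k) (uniform unitˡ s′))
    u = uniform anchorˡ s′ ++ copies (toℕ a) (uniform unitˡ s′)
    v = uniform anchorˡ s′ ++ copies (toℕ a + m * suc k) (uniform unitˡ s′)

  left-result : ∀ s m j n {s′ a} → δ s j ≡ just (s′ , a , left) →
    after-anchor s j m n ≡ codes (encode (plain anchorˡ s′) ∷ replicate m (encode (plain unitˡ s′)) ++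
                                  uniform anchorʳ s′ ++ copies (toℕ a + n * suc k) (uniform unitʳ s′))
  left-result s m j n {s′} {a} eq rewrite eq = begin
    codes [ c ] ++ copies m (codes [ d ]) ++ codes u ++ copies n p   ≡⟨ sym (++-assoc (codes [ c ]) _ _) ⟩
    (codes [ c ] ++ copies m (codes [ d ])) ++ codes u ++ copies n p
      ≡⟨ cong₂ _++_ (shrink m c d) (grow (toℕ a) n (uniform anchorʳ s′) (uniform unitʳ s′)) ⟩
    codes (c ∷ replicate m d) ++ codes v ≡⟨ sym (codes-++ (c ∷ replicate m d) v) ⟩
    codes (c ∷ replicate m d ++ v) ∎
    where
    open ≡-Reasoning
    c = encode (plain anchorˡ s′)
    d = encode (plain unitˡ s′)
    p = codes (copies (suc k) (uniform unitʳ s′))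
    u = uniform anchorʳ s′ ++ copies (toℕ a) (uniform unitʳ s′)
    v = uniform anchorʳ s′ ++ copies (toℕ a + n * suc k) (uniform unitʳ s′)

  value : List Symbol → ℕ
  value []      = 0
  value (a ∷ w) = toℕ a + value w * suc k

  represent : ID → List Bool
  represent (s , tape l a r) = standard s (value l) a (value r)

  -- An empty half has number 0, and dividing 0 yields a blank and an empty half again, just as
  -- `move` does.
  second-pass : ∀ s l a r {s′ a′ d} → δ s a ≡ just (s′ , a′ , d) →
                after-anchor s a (value l) (value r) ⟶* represent (s′ , move d (tape l a′ r))
  second-pass s []      a r {s′} {a′} {left} eq = left-result s 0 a (value r) eq ≡◅ second-pass-left s′ 0 zero (value (a′ ∷ r))
  second-pass s (b ∷ l) a r {s′} {a′} {left} eq =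
    left-result s (value (b ∷ l)) a (value r) eq ≡◅ second-pass-left s′ (value l) b (value (a′ ∷ r))
  second-pass s l a []      {s′} {a′} {right} eq =
    right-result s (value l) a 0 eq ≡◅ second-pass-right s′ (value (a′ ∷ l)) zero 0
  second-pass s l a (b ∷ r) {s′} {a′} {right} eq =
    right-result s (value l) a (value (b ∷ r)) eq ≡◅ second-pass-right s′ (value (a′ ∷ l)) b (value r)

  step-just : ∀ {s l a r c} → step (s , tape l a r) ≡ just c →
              ∃[ s′ ] ∃[ a′ ] ∃[ d ] δ s a ≡ just (s′ , a′ , d) × c ≡ (s′ , move d (tape l a′ r))
  step-just {s} {l} {a} eq with δ s a
  step-just refl | just (s′ , a′ , d) = s′ , a′ , d , refl , refl

  step-nothing : ∀ {s l a r} → step (s , tape l a r) ≡ nothing → δ s a ≡ nothing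
  step-nothing {s} {l} {a} eq with δ s a
  step-nothing refl | nothing = refl

  tag-step : ∀ c {c′} → step c ≡ just c′ → ∃[ w ] represent c ⟶ w × w ⟶* represent c′
  tag-step (s , tape l a r) eq with step-just eq | first-pass s (value l) a (value r)
  ... | s′ , a′ , d , δ-eq , refl | w , st , run = w , st , (run ◅◅ second-pass s l a r δ-eq)

  tag-halt : ∀ s l a r → step (s , tape l a r) ≡ nothing →
             represent (s , tape l a r) ⟶* true ∷ true ∷ codes (tallies (value (a ∷ r)))
  tag-halt s l a r eq with first-pass s (value l) a (value r)
  ... | w , st , run = st ◅ (run ◅◅ (halting-result s (value l) a (value r) (step-nothing eq) ≡◅ ε))

  -- This word has the form produced by a right move before its second pass, so the tag system
  -- itself separates the first input letter from the rest. Only the number of units depends on the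
  -- input.
  seed : ℕ → List Bool
  seed m = codes (uniform anchorˡ start ++ encode (plain anchorʳ start) ∷ replicate m (encode (plain unitʳ start)))

  tag-initial : ∀ x → seed (value (map suc x)) ⟶* represent (initial x)
  tag-initial x = cong (λ z → codes (z ++ encode (plain anchorʳ start) ∷ replicate (value (map suc x)) (encode (plain unitʳ start))))
      (sym (++-identityʳ (uniform anchorˡ start))) ≡◅ go x
    where
    go : ∀ x → codes ((uniform anchorˡ start ++ []) ++ encode (plain anchorʳ start) ∷ replicate (value (map suc x)) (encode (plain unitʳ start)))
               ⟶* represent (initial x)
    go []      = second-pass-right start 0 zero 0
    go (y ∷ x) = second-pass-right start 0 (suc y) (value (map suc x))

-- Counting cells and halting

marker : Fin 11 → ℕ
marker 1F = 1
marker _  = 0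

count : List (Fin 11) → ℕ
count []      = 0
count (s ∷ w) = marker s + count w

count-blank : ∀ w → (∀ i → entry w i ≡ 0F) → count w ≡ 0
count-blank []      e = refl
count-blank (s ∷ w) e rewrite e 0 = count-blank w (λ i → e (suc i))

count-cong : ∀ u v → (∀ i → entry u i ≡ entry v i) → count u ≡ count v
count-cong []      v       e = sym (count-blank v (λ i → sym (e i)))
count-cong (s ∷ u) []      e = count-blank (s ∷ u) e
count-cong (s ∷ u) (t ∷ v) e = cong₂ _+_ (cong marker (e 0)) (count-cong u v (λ i → e (suc i)))

image : List Passive → List (Fin 11)
image = map (λ a → ⌊ passive a ⌋)

count-image : ∀ w → count (image w) ≡ ones w
count-image []               = refl
count-image (blank ∷ w)      = count-image w
count-image (slot ∷ w)       = count-image w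
count-image (mark ∷ w)       = count-image w
count-image (bit true ∷ w)   = cong suc (count-image w)
count-image (bit false ∷ w)  = count-image w

entry-applyUpTo : ∀ (f : ℕ → Fin 11) b → (∀ i → b ≤ i → f i ≡ 0F) → ∀ i → entry (applyUpTo f b) i ≡ f i
entry-applyUpTo f zero    e i       = sym (e i z≤n)
entry-applyUpTo f (suc b) e zero    = refl
entry-applyUpTo f (suc b) e (suc i) = entry-applyUpTo (λ i → f (suc i)) b (λ i b≤i → e (suc i) (s≤s b≤i)) i

bound : List ℤ → ℕ
bound []       = 0
bound (i ∷ is) = suc ∣ i ∣ ⊔ bound is

bounded : ∀ {i is} → i ∈ is → ∣ i ∣ < bound is
bounded {is = j ∷ is} (here refl) = m≤m⊔n _ (bound is)
bounded {is = j ∷ is} (there p)   = ≤-trans (bounded p) (m≤n⊔m (suc ∣ j ∣) (bound is))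

total : FiniteConfiguration → ℕ
total (c , cells , _) = count (applyUpTo (λ i → c -[1+ i ]) (bound cells)) + count (applyUpTo (λ i → c (ℤ.+ i)) (bound cells))

-- The count depends neither on the finiteness witness nor on blanks at the ends of a code, as
-- computability of the decoder requires.
total-unique : ∀ C u v → ⟨ u ∣ v ⟩ ≗ proj₁ C → total C ≡ count u + count v
total-unique (c , cells , empty) u v e = cong₂ _+_
  (count-cong (applyUpTo (λ i → c -[1+ i ]) (bound cells)) u (λ i → trans (entry-applyUpTo _ (bound cells) outsideˡ i) (sym (e -[1+ i ]))))
  (count-cong (applyUpTo (λ i → c (ℤ.+ i)) (bound cells)) v (λ i → trans (entry-applyUpTo _ (bound cells) outsideʳ i) (sym (e (ℤ.+ i)))))
  where
  outsideˡ : ∀ i → bound cells ≤ i → c -[1+ i ] ≡ 0F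
  outsideˡ i b≤i = empty -[1+ i ] (λ p → <⇒≱ (bounded p) (≤-trans b≤i (n≤1+n i)))
  outsideʳ : ∀ i → bound cells ≤ i → c (ℤ.+ i) ≡ 0F
  outsideʳ i b≤i = empty (ℤ.+ i) (λ p → <⇒≱ (bounded p) b≤i)

finite : ∀ u v → Finite ⟨ u ∣ v ⟩
finite u v = map -[1+_] (upTo (length u)) ++ map ℤ.+_ (upTo (length v)) , outside
  where
  beyond : ∀ w i → length w ≤ i → entry w i ≡ 0F
  beyond []      i       _       = refl
  beyond (_ ∷ w) (suc i) (s≤s p) = beyond w i p
  outside : ∀ i → i ∉ map -[1+_] (upTo (length u)) ++ map ℤ.+_ (upTo (length v)) → ⟨ u ∣ v ⟩ i ≡ 0F
  outside (ℤ.+ i) i∉ with length v ≤? i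
  ... | yes p = beyond v i p
  ... | no  p with () ← i∉ (∈-++⁺ʳ (map -[1+_] (upTo (length u))) (∈-map⁺ ℤ.+_ (∈-upTo⁺ (≰⇒> p))))
  outside -[1+ i ] i∉ with length u ≤? i
  ... | yes p = beyond u i p
  ... | no  p with () ← i∉ (∈-++⁺ˡ (∈-map⁺ -[1+_] (∈-upTo⁺ (≰⇒> p))))

rightward-entry : ∀ {c n} w → Rightward c (ℤ.+ n) w → ∀ i → c (ℤ.+ (n + i)) ≡ entry (image w) i
rightward-entry {c} {n} [] r i = trans (cong c (sym (far i))) (r i)
  where
  far : ∀ i → fold (ℤ.+ n) ℤ.suc i ≡ ℤ.+ (n + i)
  far zero    = cong ℤ.+_ (sym (+-identityʳ n))
  far (suc i) = trans (cong ℤ.suc (far i)) (cong ℤ.+_ (sym (+-suc n i)))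
rightward-entry {c} {n} (a ∷ w) (e , r) zero    = trans (cong (λ i → c (ℤ.+ i)) (+-identityʳ n)) e
rightward-entry {c} {n} (a ∷ w) (e , r) (suc i) = trans (cong (λ i → c (ℤ.+ i)) (+-suc n i)) (rightward-entry w r i)

entry-rightward : ∀ {c n} w → (∀ i → c (ℤ.+ (n + i)) ≡ entry (image w) i) → Rightward c (ℤ.+ n) w
entry-rightward {c} {n} [] e i = trans (cong c (far i)) (e i)
  where
  far : ∀ i → fold (ℤ.+ n) ℤ.suc i ≡ ℤ.+ (n + i)
  far zero    = cong ℤ.+_ (sym (+-identityʳ n))
  far (suc i) = trans (cong ℤ.suc (far i)) (cong ℤ.+_ (sym (+-suc n i)))
entry-rightward {c} {n} (a ∷ w) e = trans (cong (λ i → c (ℤ.+ i)) (sym (+-identityʳ n))) (e 0) ,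
  entry-rightward w (λ i → trans (cong (λ i → c (ℤ.+ i)) (sym (+-suc n i))) (e (suc i)))

leftward-entry : ∀ {c n} w → Leftward c -[1+ n ] w → ∀ i → c -[1+ n + i ] ≡ entry (image w) i
leftward-entry {c} {n} [] r i = trans (cong c (sym (far i))) (r i)
  where
  far : ∀ i → fold -[1+ n ] ℤ.pred i ≡ -[1+ n + i ]
  far zero    = cong -[1+_] (sym (+-identityʳ n))
  far (suc i) = trans (cong ℤ.pred (far i)) (cong -[1+_] (sym (+-suc n i)))
leftward-entry {c} {n} (a ∷ w) (e , r) zero    = trans (cong (λ i → c -[1+ i ]) (+-identityʳ n)) e
leftward-entry {c} {n} (a ∷ w) (e , r) (suc i) = trans (cong (λ i → c -[1+ i ]) (+-suc n i)) (leftward-entry w r i)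

entry-leftward : ∀ {c n} w → (∀ i → c -[1+ n + i ] ≡ entry (image w) i) → Leftward c -[1+ n ] w
entry-leftward {c} {n} [] e i = trans (cong c (far i)) (e i)
  where
  far : ∀ i → fold -[1+ n ] ℤ.pred i ≡ -[1+ n + i ]
  far zero    = cong -[1+_] (sym (+-identityʳ n))
  far (suc i) = trans (cong ℤ.pred (far i)) (cong -[1+_] (sym (+-suc n i)))
entry-leftward {c} {n} (a ∷ w) e = trans (cong (λ i → c -[1+ i ]) (sym (+-identityʳ n))) (e 0) ,
  entry-leftward w (λ i → trans (cong (λ i → c -[1+ i ]) (sym (+-suc n i))) (e (suc i)))

AtOrigin : Configuration → ℕ → Set
AtOrigin c m = ∃[ l ] ∃[ r ] Leftward c (ℤ.pred (ℤ.+ 0)) l × Rightward c (ℤ.+ 0) r × ones l + ones r ≡ m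

ones-first : ∀ w → ones (first w ∷ []) + ones (rest w) ≡ ones w
ones-first []               = refl
ones-first (blank ∷ w)      = refl
ones-first (slot ∷ w)       = refl
ones-first (mark ∷ w)       = refl
ones-first (bit true ∷ w)   = refl
ones-first (bit false ∷ w)  = refl

ones-∷ : ∀ a w → ones (a ∷ w) ≡ ones (a ∷ []) + ones w
ones-∷ blank       w = refl
ones-∷ slot        w = refl
ones-∷ mark        w = refl
ones-∷ (bit true)  w = refl
ones-∷ (bit false) w = refl

slide-left : ∀ l r → ones (rest l) + ones (first l ∷ r) ≡ ones l + ones r
slide-left l r = trans (cong (λ z → ones (rest l) + z) (ones-∷ (first l) r))
  (trans (sym (+-assoc (ones (rest l)) _ _)) (cong (λ z → z + ones r) (trans (+-comm (ones (rest l)) _) (ones-first l))))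

slide-right : ∀ l r → ones (first r ∷ l) + ones (rest r) ≡ ones l + ones r
slide-right l r = trans (+-comm (ones (first r ∷ l)) _) (trans (slide-left r l) (+-comm (ones r) _))

-- Snapshots may lie anywhere while codes split the line at 0; the split is moved there cell by
-- cell.
recentre : ∀ {c} p l r → Leftward c (ℤ.pred p) l → Rightward c p r → AtOrigin c (ones l + ones r)
recentre (ℤ.+ zero) l r L R = l , r , L , R , refl
recentre {c} (ℤ.+ suc n) l r L R with recentre (ℤ.+ n) (rest l) (first l ∷ r) (leftward-rest l L) (leftward-fst l L , R)
... | l′ , r′ , L′ , R′ , eq = l′ , r′ , L′ , R′ , trans eq (slide-left l r)
recentre {c} -[1+ zero ] l r L R =
  first r ∷ l , rest r , (rightward-fst r R , L) , rightward-rest r R , slide-right l r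
recentre {c} -[1+ suc n ] l r L R with recentre -[1+ n ] (first r ∷ l) (rest r) (rightward-fst r R , L) (rightward-rest r R)
... | l′ , r′ , L′ , R′ , eq = l′ , r′ , L′ , R′ , trans eq (slide-right l r)

dead-total : ∀ {c l r} fin → Shows c (dead l r) → total (c , fin) ≡ ones l + ones r
dead-total {c} {l} {r} fin (p , L , R) with recentre p l r L R
... | l′ , r′ , L′ , R′ , eq = trans (total-unique (c , fin) (image l′) (image r′) same)
  (trans (cong₂ _+_ (count-image l′) (count-image r′)) eq)
  where
  same : ⟨ image l′ ∣ image r′ ⟩ ≗ c
  same (ℤ.+ i)    = sym (rightward-entry r′ R′ i)
  same -[1+ i ] = sym (leftward-entry l′ L′ i)

dead-fixed : ∀ {c l r} → Shows c (dead l r) → global c ≗ c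
dead-fixed {c} {l} {r} (p , L , R) with recentre p l r L R
... | l′ , r′ , L′ , R′ , eq = fixed
  where
  still : ∀ w i → ∃[ a ] entry (image w) i ≡ ⌊ passive a ⌋
  still []      i       = blank , refl
  still (a ∷ w) zero    = a , refl
  still (a ∷ w) (suc i) = still w i
  quiet : ∀ i → ∃[ a ] c i ≡ ⌊ passive a ⌋
  quiet (ℤ.+ i)    with still r′ i
  ... | a , e = a , trans (rightward-entry r′ R′ i) e
  quiet -[1+ i ] with still l′ i
  ... | a , e = a , trans (leftward-entry l′ L′ i) e
  fixed : global c ≗ c
  fixed i with quiet (ℤ.pred i) | quiet i | quiet (ℤ.suc i)
  ... | a , e₁ | b , e₂ | d , e₃ = trans (global-at c i (passive a) (passive b) (passive d) e₁ e₂ e₃) (sym e₂)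

after-global : ∀ t C → proj₁ (after t C) ≡ fold (proj₁ C) global t
after-global zero    C = refl
after-global (suc t) C = cong global (after-global t C)

global-cong : ∀ {c d} → c ≗ d → global c ≗ global d
global-cong e i rewrite e (ℤ.pred i) | e i | e (ℤ.suc i) = refl

halts-later : ∀ {C t} → HaltsAt C t → ∀ i → HaltsAt C (i + t)
halts-later h zero    = h
halts-later h (suc i) = global-cong (halts-later h i)

State : List Letter → ℕ → List Bool → Snapshot
State cs g w = live sentinel next (prog cs (closed g w))

-- The departing `next` leaves a mark in its own cell.
state-moves : ∀ {c cs g w} → Shows c (State cs g w) → ¬ (global c ≗ c)
state-moves {c} (p , (e₁ , _) , e₂ , (e₃ , _)) fixed
  with () ← trans (sym (global-at c p (passive (bit true)) (head next) (passive slot) e₁ e₂ e₃)) (trans (fixed p) e₂)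

-- Recursive functions on codes

Program : ∀ {n} → (Vec ℕ n → ℕ) → Set
Program {n} f = Σ[ e ∈ Recursive n ] (∀ xs → e [ xs ]↦ f xs)

ext : ∀ {n} {f g : Vec ℕ n → ℕ} → (∀ xs → f xs ≡ g xs) → Program f → Program g
ext eq (e , ev) = e , λ xs → subst (e [ xs ]↦_) (eq xs) (ev xs)

var : ∀ {n} (i : Fin n) → Program (λ xs → lookup xs i)
var i = proj i , λ xs → proj

compose₁ : ∀ {n} {f : Vec ℕ 1 → ℕ} {g : Vec ℕ n → ℕ} → Program f → Program g → Program (λ xs → f (g xs ∷ []))
compose₁ (e , ev) (d , dv) = comp e (d ∷ []) , λ xs → comp (dv xs ∷ []) (ev _)

compose₂ : ∀ {n} {f : Vec ℕ 2 → ℕ} {g h : Vec ℕ n → ℕ} → Program f → Program g → Program h →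
           Program (λ xs → f (g xs ∷ h xs ∷ []))
compose₂ (e , ev) (d , dv) (c , cv) = comp e (d ∷ c ∷ []) , λ xs → comp (dv xs ∷ cv xs ∷ []) (ev _)

compose₃ : ∀ {n} {f : Vec ℕ 3 → ℕ} {g h i : Vec ℕ n → ℕ} → Program f → Program g → Program h → Program i →
           Program (λ xs → f (g xs ∷ h xs ∷ i xs ∷ []))
compose₃ (e , ev) (d , dv) (c , cv) (b , bv) =
  comp e (d ∷ c ∷ b ∷ []) , λ xs → comp (dv xs ∷ cv xs ∷ bv xs ∷ []) (ev _)

constant : ∀ {n} m → Program {n} (λ _ → m)
constant zero    = comp zero [] , λ xs → comp [] zero
constant (suc m) with constant m
... | e , ev = comp succ (e ∷ []) , λ xs → comp (ev xs ∷ []) succ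

successor : ∀ {n} {f : Vec ℕ n → ℕ} → Program f → Program (λ xs → suc (f xs))
successor (e , ev) = comp succ (e ∷ []) , λ xs → comp (ev xs ∷ []) succ

-- This is the function that `prec` evaluates to; each program is identified with its intended
-- function afterwards, by `ext`.
recursion : ∀ {n} → (Vec ℕ n → ℕ) → (Vec ℕ (2 + n) → ℕ) → Vec ℕ (suc n) → ℕ
recursion f g (zero  ∷ xs) = f xs
recursion f g (suc i ∷ xs) = g (i ∷ recursion f g (i ∷ xs) ∷ xs)

recurse : ∀ {n} {f : Vec ℕ n → ℕ} {g : Vec ℕ (2 + n) → ℕ} → Program f → Program g → Program (recursion f g)
recurse {f = f} {g} (d , dv) (e , ev) = prec d e , go
  where
  go : ∀ xs → prec d e [ xs ]↦ recursion f g xs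
  go (zero  ∷ xs) = prec-0 (dv xs)
  go (suc i ∷ xs) = prec-s (go (i ∷ xs)) (ev _)

infixl 6 _⊕_ _⊖_
infixl 7 _⊗_

_⊕_ : ∀ {n} {f g : Vec ℕ n → ℕ} → Program f → Program g → Program (λ xs → f xs + g xs)
p ⊕ r = compose₂ (ext eq (recurse (var 0F) (successor (var 1F)))) p r
  where
  eq : ∀ xs → recursion (λ xs → lookup xs 0F) (λ xs → suc (lookup xs 1F)) xs ≡ lookup xs 0F + lookup xs 1F
  eq (zero  ∷ y ∷ []) = refl
  eq (suc i ∷ y ∷ []) = cong suc (eq (i ∷ y ∷ []))

_⊗_ : ∀ {n} {f g : Vec ℕ n → ℕ} → Program f → Program g → Program (λ xs → f xs * g xs)
p ⊗ r = compose₂ (ext eq (recurse (constant 0) (var 2F ⊕ var 1F))) p r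
  where
  eq : ∀ xs → recursion {1} (λ _ → 0) (λ xs → lookup xs 2F + lookup xs 1F) xs ≡ lookup xs 0F * lookup xs 1F
  eq (zero  ∷ y ∷ []) = refl
  eq (suc i ∷ y ∷ []) = cong (y +_) (eq (i ∷ y ∷ []))

predecessor : ∀ {n} {f : Vec ℕ n → ℕ} → Program f → Program (λ xs → pred (f xs))
predecessor p = compose₁ (ext eq (recurse (constant 0) (var 0F))) p
  where
  eq : ∀ xs → recursion {0} (λ _ → 0) (λ xs → lookup xs 0F) xs ≡ pred (lookup xs 0F)
  eq (zero  ∷ []) = refl
  eq (suc i ∷ []) = refl

_⊖_ : ∀ {n} {f g : Vec ℕ n → ℕ} → Program f → Program g → Program (λ xs → f xs ∸ g xs)
p ⊖ r = compose₂ (ext eq (recurse (var 0F) (predecessor (var 1F)))) r p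
  where
  eq : ∀ xs → recursion (λ xs → lookup xs 0F) (λ xs → pred (lookup xs 1F)) xs ≡ lookup xs 1F ∸ lookup xs 0F
  eq (zero  ∷ y ∷ []) = refl
  eq (suc i ∷ y ∷ []) = trans (cong pred (eq (i ∷ y ∷ []))) (pred[m∸n]≡m∸[1+n] y i)

ifZero : ℕ → ℕ → ℕ → ℕ
ifZero zero    a b = a
ifZero (suc _) a b = b

branch : ∀ {n} {f g h : Vec ℕ n → ℕ} → Program f → Program g → Program h → Program (λ xs → ifZero (f xs) (g xs) (h xs))
branch p r s = compose₃ (ext eq (recurse (var 0F) (var 3F))) p r s
  where
  eq : ∀ xs → recursion {2} (λ xs → lookup xs 0F) (λ xs → lookup xs 3F) xs ≡
              ifZero (lookup xs 0F) (lookup xs 1F) (lookup xs 2F)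
  eq (zero  ∷ y ∷ z ∷ []) = refl
  eq (suc i ∷ y ∷ z ∷ []) = refl

Program₁ : (ℕ → ℕ) → Set
Program₁ f = Program {1} (λ xs → f (lookup xs 0F))

Program₂ : (ℕ → ℕ → ℕ) → Set
Program₂ f = Program {2} (λ xs → f (lookup xs 0F) (lookup xs 1F))

-- The divisor is k + 1.
remainder quotient : ℕ → ℕ → ℕ
remainder k zero    = 0
remainder k (suc n) = ifZero (k ∸ remainder k n) 0 (suc (remainder k n))
quotient k zero    = 0
quotient k (suc n) = ifZero (k ∸ remainder k n) (suc (quotient k n)) (quotient k n)

remainder-program : ∀ k → Program₁ (remainder k)
remainder-program k = ext eq (recurse (constant 0) (branch (constant k ⊖ var 1F) (constant 0) (successor (var 1F))))
  where
  eq : ∀ xs → recursion {0} (λ _ → 0) (λ xs → ifZero (k ∸ lookup xs 1F) 0 (suc (lookup xs 1F))) xs ≡ remainder k (lookup xs 0F)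
  eq (zero  ∷ []) = refl
  eq (suc i ∷ []) = cong (λ y → ifZero (k ∸ y) 0 (suc y)) (eq (i ∷ []))

quotient-program : ∀ k → Program₁ (quotient k)
quotient-program k = ext eq (recurse (constant 0)
    (branch (constant k ⊖ compose₁ (remainder-program k) (var 0F)) (successor (var 1F)) (var 1F)))
  where
  eq : ∀ xs → recursion {0} (λ _ → 0) (λ xs → ifZero (k ∸ remainder k (lookup xs 0F)) (suc (lookup xs 1F)) (lookup xs 1F)) xs
              ≡ quotient k (lookup xs 0F)
  eq (zero  ∷ []) = refl
  eq (suc i ∷ []) = cong (λ y → ifZero (k ∸ remainder k i) (suc y) y) (eq (i ∷ []))

-- Lexicographic induction on `m` and `a`: just before `(m + 1)(k + 1)` the remainder is `k`, so
-- there it falls to 0 and the quotient grows.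
division : ∀ k m a → a ≤ k → remainder k (a + m * suc k) ≡ a × quotient k (a + m * suc k) ≡ m
division k zero zero _ = refl , refl
division k (suc m) zero _ with division k m k ≤-refl
... | r , d rewrite r | d | n∸n≡0 k = refl , refl
division k m (suc a) a<k with division k m a (<⇒≤ a<k)
... | r , d rewrite r | d with k ∸ a | m<n⇒0<n∸m a<k
... | suc _ | _ = refl , refl

-- Recursion along iterates and along the letters of a code

unwind : (ℕ → ℕ) → (ℕ → ℕ → ℕ) → ℕ → ℕ → ℕ
unwind τ h zero    n = 0
unwind τ h (suc i) n = h n (unwind τ h i (τ n))

-- Primitive recursion from the deepest call outwards: after i rounds, the
-- accumulator is the value at the (n - i)-th iterate of τ.
unwind-program : ∀ {τ h} → Program₁ τ → Program₂ h → Program₁ (λ n → unwind τ h n n)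
unwind-program {τ} {h} t p = ext result (compose₂ rounds (var 0F) (var 0F))
  where
  iterates : Program₂ (λ i n → fold n τ i)
  iterates = ext eq (recurse (var 0F) (compose₁ t (var 1F)))
    where
    eq : ∀ xs → recursion (λ xs → lookup xs 0F) (λ xs → τ (lookup xs 1F)) xs ≡ fold (lookup xs 1F) τ (lookup xs 0F)
    eq (zero  ∷ y ∷ []) = refl
    eq (suc i ∷ y ∷ []) = cong τ (eq (i ∷ y ∷ []))
  round : Vec ℕ 3 → ℕ
  round xs = h (fold (lookup xs 2F) τ (lookup xs 2F ∸ suc (lookup xs 0F))) (lookup xs 1F)
  rounds : Program (recursion {1} (λ _ → 0) round)
  rounds = recurse (constant 0) (compose₂ p (compose₂ iterates (var 2F ⊖ successor (var 0F)) (var 2F)) (var 1F))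
  invariant : ∀ i n → i ≤ n → recursion {1} (λ _ → 0) round (i ∷ n ∷ []) ≡ unwind τ h i (fold n τ (n ∸ i))
  invariant zero    n _   = refl
  invariant (suc i) n i<n = cong (h (fold n τ (n ∸ suc i)))
    (trans (invariant i n (<⇒≤ i<n)) (cong (λ j → unwind τ h i (fold n τ j)) (+-∸-assoc 1 i<n)))
  result : ∀ xs → recursion {1} (λ _ → 0) round (lookup xs 0F ∷ lookup xs 0F ∷ []) ≡ unwind τ h (lookup xs 0F) (lookup xs 0F)
  result (n ∷ []) = trans (invariant n n ≤-refl) (cong (λ j → unwind τ h n (fold n τ j)) (n∸n≡0 n))

-- A letter contributes its index plus one to a bijective numeral, hence `pred` before the division.
digit rest-digits : ℕ → ℕ → ℕ
digit       k n = remainder k (pred n)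
rest-digits k n = quotient k (pred n)

digit-program : ∀ k → Program₁ (digit k)
digit-program k = compose₁ (remainder-program k) (predecessor (var 0F))

rest-digits-program : ∀ k → Program₁ (rest-digits k)
rest-digits-program k = compose₁ (quotient-program k) (predecessor (var 0F))

-- The digits are those of the bijective numeration in base k + 1.
gather : ℕ → (ℕ → ℕ → ℕ) → ℕ → ℕ
gather k h n = unwind (rest-digits k) (λ m z → ifZero m 0 (h (digit k m) z)) n n

gather-program : ∀ k {h} → Program₂ h → Program₁ (gather k h)
gather-program k p = unwind-program (rest-digits-program k)
  (branch (var 0F) (constant 0) (compose₂ p (compose₁ (digit-program k) (var 0F)) (var 1F)))

code-digits : ∀ {k} (x : Fin (suc k)) w → digit k (code (x ∷ w)) ≡ toℕ x × rest-digits k (code (x ∷ w)) ≡ code w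
code-digits {k} x w rewrite *-comm (suc k) (code w) = division k (code w) (toℕ x) (≤-pred (toℕ<n x))

length≤code : ∀ {k} (w : List (Fin k)) → length w ≤ code w
length≤code []                  = z≤n
length≤code {suc k} (x ∷ w) = s≤s (≤-trans (length≤code w) (≤-trans (m≤m+n (code w) _) (m≤n+m _ (toℕ x))))

-- The code itself is a sufficient number of rounds, since every letter adds at least 1 to it. The
-- divisor is given by its predecessor, and over the empty alphabet there is only the empty word.
gather-code : ∀ {k} h (w : List (Fin k)) → gather (pred k) h (code w) ≡ List.foldr (λ x → h (toℕ x)) 0 w
gather-code {zero}  h []      = refl
gather-code {suc k} h w = go (code w) w (length≤code w)
  where
  go : ∀ i w → length w ≤ i →
       unwind (rest-digits k) (λ m z → ifZero m 0 (h (digit k m) z)) i (code w) ≡ List.foldr (λ x → h (toℕ x)) 0 w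
  go zero    []      _       = refl
  go (suc i) []      _       = refl
  go (suc i) (x ∷ w) (s≤s p) = cong₂ h (proj₁ (code-digits x w))
    (trans (cong (unwind _ _ i) (proj₂ (code-digits x w))) (go i w p))

code-++ : ∀ {k} (u v : List (Fin k)) → code (u ++ v) ≡ code u + k ^ length u * code v
code-++ {k} []      v = sym (*-identityˡ (code v))
code-++ {k} (x ∷ u) v = begin
  suc (toℕ x) + k * code (u ++ v)                             ≡⟨ cong (λ z → suc (toℕ x) + k * z) (code-++ u v) ⟩
  suc (toℕ x) + k * (code u + k ^ length u * code v)           ≡⟨ cong (suc (toℕ x) +_) (*-distribˡ-+ k (code u) _) ⟩
  suc (toℕ x) + (k * code u + k * (k ^ length u * code v))     ≡⟨ sym (+-assoc (suc (toℕ x)) (k * code u) _) ⟩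
  suc (toℕ x) + k * code u + k * (k ^ length u * code v)
    ≡⟨ cong (suc (toℕ x) + k * code u +_) (sym (*-assoc k (k ^ length u) (code v))) ⟩
  suc (toℕ x) + k * code u + k * k ^ length u * code v         ∎
  where open ≡-Reasoning

-- Prepending a fixed word acts on codes as an affine map, which is iterated by primitive recursion.
repetition-program : ∀ {k} (u v : List (Fin k)) → Program₁ (λ n → code (u ++ concat (replicate n v)))
repetition-program {k} u v = ext (λ xs → sym (code-++ u (concat (replicate (lookup xs 0F) v))))
  (constant (code u) ⊕ (constant (k ^ length u) ⊗
    ext eq (recurse (constant 0) (constant (code v) ⊕ (constant (k ^ length v) ⊗ var 1F)))))
  where
  eq : ∀ xs → recursion {0} (λ _ → 0) (λ xs → code v + k ^ length v * lookup xs 1F) xs ≡ code (concat (replicate (lookup xs 0F) v))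
  eq (zero  ∷ []) = refl
  eq (suc i ∷ []) = trans (cong (λ z → code v + k ^ length v * z) (eq (i ∷ []))) (sym (code-++ v (concat (replicate i v))))

-- Universality

prog-++ : ∀ cs t u → prog cs (t ++ u) ≡ prog cs t ++ u
prog-++ []       t u = refl
prog-++ (c ∷ cs) t u = cong (λ z → slot ∷ cell c ∷ z) (prog-++ cs t u)

map-copies : ∀ {A B : Set} (f : A → B) n b → map f (copies n b) ≡ copies n (map f b)
map-copies f zero    b = refl
map-copies f (suc n) b = trans (map-++ f b (copies n b)) (cong (map f b ++_) (map-copies f n b))

ones-falses : ∀ n w → ones (map bit (replicate n false ++ w)) ≡ ones (map bit w)
ones-falses zero    w = refl
ones-falses (suc n) w = ones-falses n w

ones-oneHot : ∀ {n} (a : Fin n) w → ones (map bit (oneHot a ++ w)) ≡ suc (ones (map bit w))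
ones-oneHot {suc n} zero    w = cong suc (ones-falses n w)
ones-oneHot {suc n} (suc a) w = ones-oneHot a w

-- Each one-hot code contains a single 1, whichever letter it encodes.
ones-codes : ∀ {n} (w : List (Fin n)) → ones (map bit (codes w)) ≡ List.length w
ones-codes []      = refl
ones-codes (a ∷ w) = trans (ones-oneHot a (codes w)) (cong suc (ones-codes w))

remainder≤ : ∀ k n → remainder k n ≤ k
remainder≤ k zero = z≤n
remainder≤ k (suc n) with k ∸ remainder k n in eq
... | zero  = z≤n
... | suc _ = m∸n≢0⇒n<m (λ e → contradiction (trans (sym eq) e) (λ ()))

isOne : ℕ → ℕ
isOne d = ifZero d 0 (ifZero (d ∸ 1) 1 0)

isOne-marker : ∀ s → isOne (toℕ s) ≡ marker s
isOne-marker 0F = refl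
isOne-marker 1F = refl
isOne-marker 2F = refl
isOne-marker 3F = refl
isOne-marker 4F = refl
isOne-marker 5F = refl
isOne-marker 6F = refl
isOne-marker 7F = refl
isOne-marker 8F = refl
isOne-marker 9F = refl
isOne-marker (suc 9F) = refl

count-program : Program₁ (gather 10 (λ d z → isOne d + z))
count-program = gather-program 10 {λ d z → isOne d + z}
  (branch (var 0F) (constant 0) (branch (var 0F ⊖ constant 1) (constant 1) (constant 0)) ⊕ var 1F)

gather-count : ∀ w → gather 10 (λ d z → isOne d + z) (code w) ≡ count w
gather-count w = trans (gather-code {11} (λ d z → isOne d + z) w) (go w)
  where
  go : ∀ w → foldr (λ s z → isOne (toℕ s) + z) 0 w ≡ count w
  go []      = refl
  go (s ∷ w) = cong₂ _+_ (isOne-marker s) (go w)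

split-computable : ∀ {k} (u v : List (Fin k) → List (Fin 11)) (fin : ∀ a b → Finite ⟨ a ∣ b ⟩) {f g : ℕ → ℕ} →
  Program₁ f → Program₁ g → (∀ x → f (code x) ≡ code (u x)) → (∀ x → g (code x) ≡ code (v x)) →
  Computable (wordCoding k) (configurationCoding automaton) (λ x → ⟨ u x ∣ v x ⟩ , fin (u x) (v x))
split-computable u v fin (d , dv) (e , ev) eq eq′ = d ∷ e ∷ [] , λ { x _ refl →
  code (u x) ∷ code (v x) ∷ [] ,
  subst (d [ _ ]↦_) (eq x) (dv (code x ∷ [])) ∷ subst (e [ _ ]↦_) (eq′ x) (ev (code x ∷ [])) ∷ [] ,
  u x , v x , refl , λ i → refl }

joined-computable : ∀ {k} (f : FiniteConfiguration → List (Fin k)) {g : ℕ → ℕ → ℕ} → Program₂ g →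
  (∀ c u v → ⟨ u ∣ v ⟩ ≗ proj₁ c → g (code u) (code v) ≡ code (f c)) →
  Computable (configurationCoding automaton) (wordCoding k) f
joined-computable f (d , dv) eq = d ∷ [] , λ { c _ (u , v , refl , e) →
  code (f c) ∷ [] , subst (d [ _ ]↦_) (eq c u v e) (dv (code u ∷ code v ∷ [])) ∷ [] , refl }

module Universal (M : TuringMachine) where
  open TuringMachine M
  open Simulation M

  text : List Letter
  text = program k prod

  tag-move : ∀ {u v} → u ⟶ v → ∀ g → ∃[ h ] State text g u ↦⁺ State text h v
  tag-move (tag a d r len) g = tag-cycle k prod a d g r len

  tag-moves : ∀ {u v} → u ⟶* v → ∀ g → ∃[ h ] State text g u ↦* State text h v
  tag-moves ε        g = g , ε
  tag-moves (m ◅ ms) g with tag-move m g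
  ... | i , (_ , st , run) with tag-moves ms i
  ... | h , run′ = h , st ◅ run ◅◅ run′

  -- Computable encoding and decoding

  letter : ℕ → Maybe (Fin k)
  letter zero    = nothing
  letter (suc d) with d <? k
  ... | yes p = just (fromℕ< p)
  ... | no  _ = nothing

  -- The first argument bounds the number of rounds. The digit 0 is the blank, where the output
  -- ends.
  letters : ℕ → ℕ → Word
  letters zero    n = []
  letters (suc i) n with letter (remainder k n)
  ... | nothing = []
  ... | just x  = x ∷ letters i (quotient k n)

  word : ℕ → Word
  word n = letters n n

  letters-value : ∀ i l → value l ≤ i → letters i (value l) ≡ untilBlank l
  letters-value zero    []             _ = refl
  letters-value zero    (zero ∷ l)     _ = refl
  letters-value (suc i) []             _ = refl
  letters-value (suc i) (zero ∷ l)     _ rewrite proj₁ (division k (value l) 0 z≤n) = refl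
  letters-value (suc i) (suc x ∷ l) (s≤s p)
    rewrite proj₁ (division k (value l) (suc (toℕ x)) (toℕ<n x))
    with toℕ x <? k
  ... | no  q = contradiction (toℕ<n x) q
  ... | yes q = cong₂ _∷_ (fromℕ<-toℕ x q) (trans
      (cong (letters i) (proj₂ (division k (value l) (suc (toℕ x)) (toℕ<n x))))
      (letters-value i l (≤-trans (m≤m*n (value l) (suc k)) (≤-trans (m≤n+m _ (toℕ x)) p))))

  -- The digit `d + 1` in base `k + 1` is the letter `d`, which counts as `d + 1` in bijective base
  -- `k` too; so the remainder can be used as it is.
  spell : ℕ → ℕ → ℕ
  spell n z = ifZero (remainder k n) 0 (remainder k n + k * z)

  code-letters : ∀ i n → code (letters i n) ≡ unwind (quotient k) spell i n
  code-letters zero    n = refl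
  code-letters (suc i) n with remainder k n | remainder≤ k n
  ... | zero  | _ = refl
  ... | suc d | d<k with d <? k
  ... | yes p = cong₂ (λ a b → suc a + k * b) (toℕ-fromℕ< p) (code-letters i (quotient k n))
  ... | no  q = contradiction d<k q

  word-program : Program₁ (λ n → code (word n))
  word-program = ext (λ xs → sym (code-letters (lookup xs 0F) (lookup xs 0F)))
    (unwind-program (quotient-program k) (branch r (constant 0) (r ⊕ (constant k ⊗ var 1F))))
    where
    r = compose₁ (remainder-program k) (var 0F)

  number : Word → ℕ
  number x = value (map suc x)

  number-program : Program₁ (gather (pred k) (λ d z → suc d + z * suc k))
  number-program = gather-program (pred k) {λ d z → suc d + z * suc k} (successor (var 0F) ⊕ (var 1F ⊗ constant (suc k)))

  gather-number : ∀ x → gather (pred k) (λ d z → suc d + z * suc k) (code x) ≡ number x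
  gather-number x = trans (gather-code (λ d z → suc d + z * suc k) x) (go x)
    where
    go : ∀ x → foldr (λ a z → suc (toℕ a) + z * suc k) 0 x ≡ number x
    go []      = refl
    go (a ∷ x) = cong (λ z → suc (toℕ a) + z * suc k) (go x)

  encoder : (u p c : List (Fin 11)) → Word → FiniteConfiguration
  encoder u p c x = ⟨ u ∣ p ++ copies (number x) c ⟩ , finite u (p ++ copies (number x) c)

  encoder-computable : ∀ u p c → Computable (wordCoding k) (configurationCoding automaton) (encoder u p c)
  encoder-computable u p c = split-computable (λ _ → u) (λ x → p ++ copies (number x) c) finite
    {λ _ → code u} {λ n → code (p ++ copies (gather (pred k) (λ d z → suc d + z * suc k) n) c)}
    (constant (code u)) (compose₁ (repetition-program p c) (compose₁ number-program (var 0F)))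
    (λ _ → refl) (λ x → cong (λ n → code (p ++ copies n c)) (gather-number x))

  decoder : ℕ → FiniteConfiguration → Word
  decoder m c = word (total c ∸ m)

  decoder-computable : ∀ m → Computable (configurationCoding automaton) (wordCoding k) (decoder m)
  decoder-computable m = joined-computable (decoder m)
    {λ a b → code (word (gather 10 (λ d z → isOne d + z) a + gather 10 (λ d z → isOne d + z) b ∸ m))}
    (compose₁ word-program ((compose₁ count-program (var 0F) ⊕ compose₁ count-program (var 1F)) ⊖ constant m))
    (λ c u v e → cong (λ n → code (word (n ∸ m)))
      (trans (cong₂ _+_ (gather-count u) (gather-count v)) (sym (total-unique c u v e))))

  -- These are the 1s of the final configuration that do not come from tallies.
  surplus : ℕ
  surplus = 5 + marks text

  run-output : ∀ {c y} → c ⇓ y → ∀ g → ∃[ l ] ∃[ r ] ∃[ n ] State text g (represent c) ↦* dead l r ×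
               ones l + ones r ≡ surplus + n × word n ≡ y
  run-output (stop {s , tape l a r} eq) g with tag-moves (tag-halt s l a r eq) g
  ... | h , run with freeze _ h (codes (tallies (value (a ∷ r))))
  ... | l′ , r′ , run′ , total-eq = l′ , r′ , value (a ∷ r) , run ◅◅ run′ ,
        trans total-eq (cong (surplus +_) (trans (ones-codes (tallies (value (a ∷ r)))) (length-replicate (value (a ∷ r))))) ,
        letters-value (value (a ∷ r)) (a ∷ r) ≤-refl
  run-output (next {c} eq rest-run) g with tag-step c eq
  ... | w , st , sts with tag-moves (st ◅ sts) g
  ... | h , run with run-output rest-run h
  ... | l , r , n , run′ , total-eq , word-eq = l , r , n , run ◅◅ run′ , total-eq , word-eq

  prefix unit-cells : List (Fin 11)
  prefix     = ⌊ head next ⌋ ∷ image (prog text (mark ∷ map bit (codes (uniform anchorˡ start ++ [ encode (plain anchorʳ start) ]))))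
  unit-cells = image (map bit (oneHot (encode (plain unitʳ start))))

  leftCells : List (Fin 11)
  leftCells = image sentinel

  rightCells : Word → List (Fin 11)
  rightCells x = prefix ++ copies (number x) unit-cells

  rightCells-seed : ∀ x → rightCells x ≡ ⌊ head next ⌋ ∷ image (prog text (closed 0 (seed (number x))))
  rightCells-seed x = cong (⌊ head next ⌋ ∷_) (begin
    image (prog text (mark ∷ map bit b)) ++ copies n unit-cells
      ≡⟨ cong (image (prog text (mark ∷ map bit b)) ++_) (trans (sym (map-copies _ n (map bit v))) (cong image (sym (map-copies bit n v)))) ⟩
    image (prog text (mark ∷ map bit b)) ++ image (map bit (copies n v))
      ≡⟨ sym (map-++ _ (prog text (mark ∷ map bit b)) _) ⟩
    image (prog text (mark ∷ map bit b) ++ map bit (copies n v))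
      ≡⟨ cong image (sym (prog-++ text (mark ∷ map bit b) _)) ⟩
    image (prog text (mark ∷ map bit b ++ map bit (copies n v)))
      ≡⟨ cong (λ z → image (prog text (mark ∷ z))) (sym (map-++ bit b (copies n v))) ⟩
    image (prog text (closed 0 (b ++ copies n v)))
      ≡⟨ cong (λ z → image (prog text (closed 0 z))) split ⟩
    image (prog text (closed 0 (seed n))) ∎)
    where
    open ≡-Reasoning
    n = number x
    u = uniform anchorˡ start
    p = encode (plain anchorʳ start)
    e = encode (plain unitʳ start)
    v = oneHot e
    b = codes (u ++ [ p ])
    split : b ++ copies n v ≡ seed n
    split = begin
      b ++ copies n v                     ≡⟨ cong (b ++_) (sym (concatMap-replicate oneHot n e)) ⟩
      b ++ codes (replicate n e)          ≡⟨ sym (codes-++ (u ++ [ p ]) (replicate n e)) ⟩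
      codes ((u ++ [ p ]) ++ replicate n e) ≡⟨ cong codes (++-assoc u [ p ] (replicate n e)) ⟩
      seed n                              ∎

  -- Correctness of the simulation

  enc : Word → FiniteConfiguration
  enc = encoder leftCells prefix unit-cells

  enc-shows : ∀ x → Shows (proj₁ (enc x)) (State text 0 (seed (number x)))
  enc-shows x = ℤ.+ 0 , entry-leftward {proj₁ (enc x)} {0} sentinel (λ i → refl) , cong (λ w → entry w 0) (rightCells-seed x) ,
    entry-rightward (prog text (closed 0 (seed (number x)))) (λ i → cong (λ w → entry w (suc i)) (rightCells-seed x))

  dec : FiniteConfiguration → Word
  dec = decoder surplus

  halts : ∀ C {g w c y} → Shows (proj₁ C) (State text g w) → w ⟶* represent c → c ⇓ y →
          ∃[ t ] HaltsAt C t × dec (after t C) ≡ y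
  halts C {g} sh run h with tag-moves run g
  ... | i , run₁ with run-output h i
  ... | l , r , n , run₂ , total-eq , word-eq with shows-run (run₁ ◅◅ run₂) sh
  ... | t , sh₁ = t , dead-fixed {proj₁ (after t C)} sh₂ ,
    trans (cong (λ m → word (m ∸ surplus)) (trans (dead-total (proj₂ (after t C)) sh₂) total-eq))
          (trans (cong word (m+n∸m≡n surplus n)) word-eq)
    where
    sh₂ : Shows (proj₁ (after t C)) (dead l r)
    sh₂ = subst (λ d → Shows d (dead l r)) (sym (after-global t C)) sh₁

  halting : ∀ x y → HaltsOn x WithOutput y → ∃[ t ] HaltsAt (enc x) t × dec (after t (enc x)) ≡ y
  halting x y = halts (enc x) {0} (enc-shows x) (tag-initial x)

  -- The last component carries halting back to `c₀`; so if `c₀` never halts, a further machine step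
  -- from `c` is possible.
  Reached : FiniteConfiguration → ID → ℕ → Set
  Reached C c₀ n = ∃[ c ] ∃[ g ] ∃[ t ] n ≤ t × Shows (proj₁ (after t C)) (State text g (represent c)) ×
                   (∀ y → c ⇓ y → ∃[ z ] c₀ ⇓ z)

  fold-+ : ∀ {A : Set} (f : A → A) z s t → fold (fold z f t) f s ≡ fold z f (s + t)
  fold-+ f z zero    t = refl
  fold-+ f z (suc s) t = cong f (fold-+ f z s t)

  shows-after : ∀ C {z z′} t → z ↦* z′ → Shows (fold (proj₁ C) global t) z → ∃[ s ] Shows (proj₁ (after (s + t) C)) z′
  shows-after C {z} {z′} t run sh with shows-run run sh
  ... | s , sh′ = s , subst (λ d → Shows d z′) (trans (fold-+ global (proj₁ C) s t) (sym (after-global (s + t) C))) sh′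

  -- Each machine step costs at least one tag step and hence at least one step of the automaton, so
  -- the times reached are unbounded.
  reached : ∀ C {g w c₀} → Shows (proj₁ C) (State text g w) → w ⟶* represent c₀ → ¬ (∃[ y ] c₀ ⇓ y) → ∀ n → Reached C c₀ n
  reached C {g} {w} {c₀} sh run ¬h zero with tag-moves run g
  ... | i , run₁ with shows-after C 0 run₁ sh
  ... | t , sh₁ = c₀ , i , t + 0 , z≤n , sh₁ , λ y h → y , h
  reached C {g} {w} {c₀} sh run ¬h (suc n) with reached C sh run ¬h n
  ... | c , i , t , n≤t , sh₁ , back with step c in eq
  ...   | nothing = contradiction (back (output c) (stop eq)) ¬h
  ...   | just c′ with tag-step c eq
  ...     | v , m , ms with tag-move m i
  ...       | j , (z , st , run₁) with tag-moves ms j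
  ...         | i′ , run₂ with shows-after C (suc t) (run₁ ◅◅ run₂) (subst (λ d → Shows (global d) z) (after-global t C) (shows st sh₁))
  ...           | s , sh₂ = c′ , i′ , s + suc t , ≤-trans (s≤s n≤t) (m≤n+m (suc t) s) , sh₂ , λ y h → back y (next eq h)

  -- A fixed point at time `t` would persist, but at some time after `t` or at `t` itself a head is
  -- about to move.
  runs-forever : ∀ C {g w c₀} → Shows (proj₁ C) (State text g w) → w ⟶* represent c₀ → ¬ (∃[ y ] c₀ ⇓ y) → ¬ Halts C
  runs-forever C sh run ¬h (t , fixed) with reached C sh run ¬h t
  ... | c , g , s , t≤s , sh₁ , _ = state-moves {proj₁ (after s C)} {text} {g} {represent c} sh₁
    (subst (HaltsAt C) (m∸n+n≡m t≤s) (halts-later {C} {t} fixed (s ∸ t)))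

  non-halting : ∀ x → ¬ HaltsOn x → ¬ Halts (enc x)
  non-halting x = runs-forever (enc x) {0} (enc-shows x) (tag-initial x)

  simulates : Simulates automaton M
  simulates = record
    { enc            = enc
    ; dec            = dec
    ; enc-computable = encoder-computable leftCells prefix unit-cells
    ; dec-computable = decoder-computable surplus
    ; halting        = halting
    ; non-halting    = non-halting
    }

theorem1 : Σ[ A ∈ CellularAutomaton 11 ] StronglyUniversal A
theorem1 = automaton , Universal.simulates
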